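{- The adaptivity gap of the offline stochastic matching problem with one-sided probing constraints is $1-1/e$; that is, $$\inf_{G}\frac{\mathrm{OPT}_{\text{n-adap}}(G)}{\mathrm{OPT}(G)}=1-\frac1e,$$ where the infimum is over all bipartite stochastic graphs $G=(U,V,E)$ with substring-closed probing constraints $(\mathcal{C}_v)_{v\in V}$.
   Context: Stochastic graph: a bipartite graph $G=(U,V,E)$ with finite $U$, $V$, $E=U\times V$, edge weights $w_e\ge0$, probabilities $p_e\in[0,1]$. $\partial(v)$ is the set of edges containing $v$. Each edge $e$ is active independently with probability $p_e$; $\mathrm{st}(e)$ is the indicator of this event. Each $v\in V$ has a probing constraint $\mathcal{C}_v$, a nonempty set of strings (tuples, possibly empty) with pairwise distinct entries from $\partial(v)$. $\mathcal{C}_v$ is substring-closed if every substring of a string in $\mathcal{C}_v$ is also in $\mathcal{C}_v$, where a substring of $(e_1,\ldots,e_k)$ is a contiguous block $(e_i,e_{i+1},\ldots,e_j)$ of its entries, or the empty string. Offline probing algorithm: knows $G$ but not the edge states; possibly randomized; adaptively probes edges one at a time in any order (possibly interleaving edges of different $v\in V$), each probe of $e$ revealing $\mathrm{st}(e)$; for each $v\in V$ the sequence of probed edges of $\partial(v)$, in the order probed, must lie in $\mathcal{C}_v$; when a probed edge is active it must irrevocably decide whether to include it in its output before any further probe; it outputs a matching of probed active edges. $\mathrm{OPT}(G)$ is the maximum expected weight of the output over all offline probing algorithms. The algorithm is non-adaptive if its probes (which edges are probed, and in which order) are a randomized function of $G$ alone, i.e. independent of $(\mathrm{st}(e))_{e\in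 E}$. $\mathrm{OPT}_{\text{n-adap}}(G)$ is the supremum of the expected weight of the output over all non-adaptive offline probing algorithms. The infimum is over those $G$ with $\mathrm{OPT}(G)>0$. -}

module Defs where

open import Algebra.Bundles using (CommutativeRing)
open import Algebra.Structures using (IsCommutativeRing)
open import Data.Bool using (Bool; true; false; if_then_else_)
open import Data.Fin using (Fin; zero; suc; remQuot; combine; _≟_)
open import Data.List using (List; []; _∷_; filter)
open import Data.List.Relation.Binary.Infix.Heterogeneous using (Infix; here)
open import Data.List.Relation.Binary.Prefix.Heterogeneous using ([])
open import Data.List.Relation.Unary.All using (All)
open import Data.List.Relation.Unary.AllPairs using (AllPairs; [])
open import Data.List.Relation.Unary.Unique.Propositional using (Unique)
import Data.List.Membership.DecPropositional as DecMembership
open import Data.Nat using (ℕ; zero; suc)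
import Data.Nat as ℕ
open import Data.Product using (Σ; Σ-syntax; ∃; ∃-syntax; _×_; _,_; proj₁; proj₂)
open import Data.Product.Properties using (≡-dec)
open import Data.Sum using (inj₁; inj₂)
import Data.Vec.Functional as Vector
open import Function using (_∘_)
open import Level using (0ℓ)
open import Relation.Binary using (Rel; IsDecTotalOrder)
import Relation.Binary.Construct.NonStrictToStrict as ToStrict
open import Relation.Binary.PropositionalEquality
open import Relation.Nullary using (does; contradiction)
open import Relation.Unary using (Pred)

module Bounds {A : Set} (_≤_ : Rel A 0ℓ) where

  IsUpperBound IsLowerBound IsSupremum IsInfimum :
    ∀ {ℓ} → Pred A ℓ → Pred A ℓ
  IsUpperBound P b = ∀ x → P x → x ≤ b
  IsLowerBound P b = ∀ x → P x → b ≤ x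
  IsSupremum P s = IsUpperBound P s × (∀ b → IsUpperBound P b → s ≤ b)
  IsInfimum  P s = IsLowerBound P s × (∀ b → IsLowerBound P b → b ≤ s)

-- The real numbers, axiomatised as a Dedekind-complete ordered field; this
-- determines them up to unique isomorphism.  The axioms are the classical ones (decidable
-- order, a supremum for every inhabited bounded predicate), so an instance needs classical
-- logic.  The value of 0# ⁻¹ is arbitrary.
record CompleteOrderedField : Set₁ where
  infix  8 -_
  infix  9 _⁻¹
  infixl 7 _*_ _/_
  infixl 6 _+_ _-_
  infix  4 _≤_

  field
    ℝ       : Set
    _≤_     : Rel ℝ 0ℓ
    _+_ _*_ : ℝ → ℝ → ℝ
    -_ _⁻¹  : ℝ → ℝ
    0# 1#   : ℝ
    isCommutativeRing : IsCommutativeRing _≡_ _+_ _*_ -_ 0# 1#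
    isDecTotalOrder   : IsDecTotalOrder _≡_ _≤_
    1≢0         : 1# ≢ 0#
    ⁻¹-inverseʳ : ∀ x → x ≢ 0# → x * x ⁻¹ ≡ 1#
    +-monoˡ-≤   : ∀ z {x y} → x ≤ y → x + z ≤ y + z
    *-nonneg    : ∀ {x y} → 0# ≤ x → 0# ≤ y → 0# ≤ x * y

  open Bounds _≤_ public

  field
    supremum : (P : Pred ℝ 0ℓ) → ∃ P → ∃ (IsUpperBound P) → ∃ (IsSupremum P)

  sup : (P : Pred ℝ 0ℓ) → ∃ P → ∃ (IsUpperBound P) → ℝ
  sup P inhabited bounded = proj₁ (supremum P inhabited bounded)

  open ToStrict _≡_ _≤_ public using (_<_)

  _-_ _/_ : ℝ → ℝ → ℝ
  x - y = x + (- y)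
  x / y = x * y ⁻¹

  commutativeRing : CommutativeRing 0ℓ 0ℓ
  commutativeRing = record { isCommutativeRing = isCommutativeRing }

  open import Algebra.Definitions.RawMonoid
    (CommutativeRing.+-rawMonoid commutativeRing) public using (sum)

module RealLemmas (R : CompleteOrderedField) where
  open CompleteOrderedField R
  open CommutativeRing commutativeRing using
    (+-comm; +-assoc; +-identityˡ; +-identityʳ; -‿inverseˡ; -‿inverseʳ;
     *-identityˡ; distribˡ; distribʳ; zeroʳ; ring)
  open import Algebra.Properties.Ring ring using (-‿distribˡ-*; -‿involutive)
  open IsDecTotalOrder isDecTotalOrder public using (total; antisym; _≤?_)
    renaming (refl to ≤-refl; trans to ≤-trans; reflexive to ≤-reflexive)

  +-monoʳ-≤ : ∀ z {x y} → x ≤ y → z + x ≤ z + y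
  +-monoʳ-≤ z {x} {y} x≤y = subst₂ _≤_ (+-comm x z) (+-comm y z) (+-monoˡ-≤ z x≤y)

  +-mono-≤ : ∀ {x y u v} → x ≤ y → u ≤ v → x + u ≤ y + v
  +-mono-≤ {y = y} {u = u} x≤y u≤v = ≤-trans (+-monoˡ-≤ u x≤y) (+-monoʳ-≤ y u≤v)

  +-nonneg : ∀ {x y} → 0# ≤ x → 0# ≤ y → 0# ≤ x + y
  +-nonneg 0≤x 0≤y = subst (_≤ _) (+-identityˡ 0#) (+-mono-≤ 0≤x 0≤y)

  x≤y⇒0≤y-x : ∀ {x y} → x ≤ y → 0# ≤ y - x
  x≤y⇒0≤y-x {x} {y} x≤y = subst (_≤ y - x) (-‿inverseʳ x) (+-monoˡ-≤ (- x) x≤y)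

  x-y+y≡x : ∀ x y → (x - y) + y ≡ x
  x-y+y≡x x y =
    trans (+-assoc x (- y) y) (trans (cong (x +_) (-‿inverseˡ y)) (+-identityʳ x))

  0≤y-x⇒x≤y : ∀ {x y} → 0# ≤ y - x → x ≤ y
  0≤y-x⇒x≤y {x} {y} 0≤ =
    subst₂ _≤_ (+-identityˡ x) (x-y+y≡x y x) (+-monoˡ-≤ x 0≤)

  *-monoˡ-≤ : ∀ {z x y} → 0# ≤ z → x ≤ y → z * x ≤ z * y
  *-monoˡ-≤ {z} {x} {y} 0≤z x≤y = subst₂ _≤_ (+-identityˡ (z * x)) eq
    (+-monoˡ-≤ (z * x) (*-nonneg 0≤z (x≤y⇒0≤y-x x≤y)))
    where
    eq : z * (y - x) + z * x ≡ z * y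
    eq = trans (sym (distribˡ z (y - x) x)) (cong (z *_) (x-y+y≡x y x))

  0≤1 : 0# ≤ 1#
  0≤1 with total 0# 1#
  ... | inj₁ 0≤1 = 0≤1
  ... | inj₂ 1≤0 = subst (0# ≤_) eq (*-nonneg 0≤-1 0≤-1)
    where
    0≤-1 : 0# ≤ - 1#
    0≤-1 = subst (0# ≤_) (+-identityˡ (- 1#)) (x≤y⇒0≤y-x 1≤0)
    eq : (- 1#) * (- 1#) ≡ 1#
    eq = trans (sym (-‿distribˡ-* 1# (- 1#)))
               (trans (cong -_ (*-identityˡ (- 1#))) (-‿involutive 1#))

  0≤⁻¹ : ∀ {x} → 0# ≤ x → x ≢ 0# → 0# ≤ x ⁻¹
  0≤⁻¹ {x} 0≤x x≢0 with total 0# (x ⁻¹)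
  ... | inj₁ p = p
  ... | inj₂ x⁻¹≤0 = contradiction (antisym 1≤0 0≤1) 1≢0
    where
    1≤0 : 1# ≤ 0#
    1≤0 = subst₂ _≤_ (⁻¹-inverseʳ x x≢0) (zeroʳ x) (*-monoˡ-≤ 0≤x x⁻¹≤0)

  sum-mono-≤ : ∀ {k} {f g : Fin k → ℝ} → (∀ i → f i ≤ g i) → sum f ≤ sum g
  sum-mono-≤ {zero}  _   = ≤-refl
  sum-mono-≤ {suc k} f≤g = +-mono-≤ (f≤g zero) (sum-mono-≤ (f≤g ∘ suc))

  *-distribʳ-sum : ∀ {k} (f : Fin k → ℝ) c → sum (λ i → f i * c) ≡ sum f * c
  *-distribʳ-sum {zero}  f c = sym (CommutativeRing.zeroˡ commutativeRing c)
  *-distribʳ-sum {suc k} f c =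
    trans (cong (f zero * c +_) (*-distribʳ-sum (f ∘ suc) c))
          (sym (distribʳ c (f zero) (sum (f ∘ suc))))

module Euler (R : CompleteOrderedField) where
  open CompleteOrderedField R
  open RealLemmas R
  open CommutativeRing commutativeRing using
    (+-assoc; +-identityʳ; *-comm; *-assoc; *-identityʳ; distribˡ)

  fromℕ : ℕ → ℝ
  fromℕ zero    = 0#
  fromℕ (suc n) = 1# + fromℕ n

  1/_! : ℕ → ℝ
  1/ zero  ! = 1#
  1/ suc n ! = 1/ n ! / fromℕ (suc n)

  expSum : ℕ → ℝ
  expSum zero    = 0#
  expSum (suc n) = expSum n + 1/ n !

  private
    0≤fromℕ : ∀ n → 0# ≤ fromℕ n
    0≤fromℕ zero    = ≤-refl
    0≤fromℕ (suc n) = +-nonneg 0≤1 (0≤fromℕ n)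

    1≤fromℕ : ∀ n → 1# ≤ fromℕ (suc n)
    1≤fromℕ n = subst (_≤ fromℕ (suc n)) (+-identityʳ 1#) (+-monoʳ-≤ 1# (0≤fromℕ n))

    fromℕ≢0 : ∀ n → fromℕ (suc n) ≢ 0#
    fromℕ≢0 n eq = 1≢0 (antisym (subst (1# ≤_) eq (1≤fromℕ n)) 0≤1)

    0≤fromℕ⁻¹ : ∀ n → 0# ≤ fromℕ (suc n) ⁻¹
    0≤fromℕ⁻¹ n = 0≤⁻¹ (0≤fromℕ (suc n)) (fromℕ≢0 n)

    0≤1/! : ∀ n → 0# ≤ 1/ n !
    0≤1/! zero    = 0≤1
    0≤1/! (suc n) = *-nonneg (0≤1/! n) (0≤fromℕ⁻¹ n)

    double : ∀ x → x * (1# + 1#) ≡ x + x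
    double x = trans (distribˡ x 1# 1#) (cong₂ _+_ (*-identityʳ x) (*-identityʳ x))

    2≤fromℕ : ∀ n → 1# + 1# ≤ fromℕ (suc (suc n))
    2≤fromℕ n = +-monoʳ-≤ 1# (1≤fromℕ n)

    halving : ∀ n → 1/ suc (suc n) ! + 1/ suc (suc n) ! ≤ 1/ suc n !
    halving n = subst₂ _≤_ lhs rhs
      (*-monoˡ-≤ (0≤1/! (suc n)) (*-monoˡ-≤ (0≤fromℕ⁻¹ (suc n)) (2≤fromℕ n)))
      where
      d : ℝ
      d = fromℕ (suc (suc n))
      lhs : 1/ suc n ! * (d ⁻¹ * (1# + 1#)) ≡ 1/ suc (suc n) ! + 1/ suc (suc n) !
      lhs = trans (sym (*-assoc (1/ suc n !) (d ⁻¹) (1# + 1#))) (double (1/ suc (suc n) !))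
      rhs : 1/ suc n ! * (d ⁻¹ * d) ≡ 1/ suc n !
      rhs = trans (cong (1/ suc n ! *_)
                    (trans (*-comm (d ⁻¹) d) (⁻¹-inverseʳ d (fromℕ≢0 (suc n)))))
                  (*-identityʳ (1/ suc n !))

    bound : ℝ
    bound = expSum 2 + (1/ 1 ! + 1/ 1 !)

    expSum-bound : ∀ n → expSum (suc (suc n)) + (1/ suc n ! + 1/ suc n !) ≤ bound
    expSum-bound zero    = ≤-refl
    expSum-bound (suc n) = ≤-trans
      (≤-trans (≤-reflexive (+-assoc (expSum (suc (suc n))) a (a + a)))
        (+-monoʳ-≤ (expSum (suc (suc n)))
          (+-mono-≤ (≤-trans (subst (_≤ a + a) (+-identityʳ a) (+-monoʳ-≤ a (0≤1/! (suc (suc n)))))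
                             (halving n))
                    (halving n))))
      (expSum-bound n)
      where
      a : ℝ
      a = 1/ suc (suc n) !

    step : ∀ n → expSum n ≤ expSum (suc n)
    step n = subst (_≤ expSum (suc n)) (+-identityʳ (expSum n)) (+-monoʳ-≤ (expSum n) (0≤1/! n))

    expSum≤bound : ∀ n → expSum n ≤ bound
    expSum≤bound n = ≤-trans (step n) (≤-trans (step (suc n))
      (≤-trans (subst (_≤ expSum (suc (suc n)) + (1/ suc n ! + 1/ suc n !))
                      (+-identityʳ (expSum (suc (suc n))))
                      (+-monoʳ-≤ (expSum (suc (suc n)))
                                 (+-nonneg (0≤1/! (suc n)) (0≤1/! (suc n)))))
               (expSum-bound n)))

  e : ℝ
  e = sup (λ x → ∃[ n ] x ≡ expSum n)
          (0# , 0 , refl)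
          (bound , λ { _ (n , refl) → expSum≤bound n })

module StochasticProbing (R : CompleteOrderedField) where
  open CompleteOrderedField R
  open RealLemmas R
  open CommutativeRing commutativeRing using (*-identityˡ; distribʳ; +-comm)

  -- 𝔼 p f is the expectation of f over independent bits, the i-th of which is true
  -- with probability p i.
  𝔼 : ∀ {k} → (Fin k → ℝ) → ((Fin k → Bool) → ℝ) → ℝ
  𝔼 {zero}  p f = f Vector.[]
  𝔼 {suc k} p f = p zero * 𝔼 (p ∘ suc) (λ s → f (true Vector.∷ s))
                + (1# - p zero) * 𝔼 (p ∘ suc) (λ s → f (false Vector.∷ s))

  -- U = Fin |U| and V = Fin |V|.
  record StochasticGraph : Set₁ where
    field
      |U| |V| : ℕ

    Edge : Set
    Edge = Fin |U| × Fin |V|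

    field
      w   : Edge → ℝ
      p   : Edge → ℝ
      0≤w : ∀ e → 0# ≤ w e
      0≤p : ∀ e → 0# ≤ p e
      p≤1 : ∀ e → p e ≤ 1#

      𝒞          : Fin |V| → Pred (List Edge) 0ℓ
      𝒞-nonempty : ∀ v → ∃ (𝒞 v)
      𝒞-incident : ∀ v s → 𝒞 v s → All (λ e → proj₂ e ≡ v) s
      𝒞-distinct : ∀ v s → 𝒞 v s → Unique s

  open StochasticGraph public using (|U|; |V|)

  SubstringClosed : StochasticGraph → Set
  SubstringClosed G = ∀ v s t → Infix _≡_ t s → 𝒞 v s → 𝒞 v t
    where open StochasticGraph G

  module Probing (G : StochasticGraph) where
    open StochasticGraph G hiding (|U|; |V|)
    open DecMembership (≡-dec (_≟_ {|U| G}) (_≟_ {|V| G})) using (_∈?_)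

    State : Set
    State = Edge → Bool

    fromBits : (Fin (|U| G ℕ.* |V| G) → Bool) → State
    fromBits s (u , v) = s (combine u v)

    -- A deterministic adaptive algorithm.  In  probe e a π₁ π₀  the edge e is probed;
    -- if it is active, it is put into the output when a is true (and is lost otherwise),
    -- and π₁ is run; if it is inactive, π₀ is run.
    data Policy : Set where
      stop  : Policy
      probe : Edge → Bool → Policy → Policy → Policy

    probes : Policy → State → List Edge
    probes stop              st = []
    probes (probe e a π₁ π₀) st = e ∷ (if st e then probes π₁ st else probes π₀ st)

    output : Policy → State → List Edge
    output stop              st = []
    output (probe e a π₁ π₀) st =
      if st e then (if a then e ∷ output π₁ st else output π₁ st)
              else output π₀ st

    IsMatching : List Edge → Set
    IsMatching = AllPairs λ (u , v) (u′ , v′) → u ≢ u′ × v ≢ v′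

    record Valid (π : Policy) : Set where
      field
        respects : ∀ st v → 𝒞 v (filter (λ e → proj₂ e ≟ v) (probes π st))
        matching : ∀ st → IsMatching (output π st)

    weight : List Edge → ℝ
    weight M = sum λ u → sum λ v → if does ((u , v) ∈? M) then w (u , v) else 0#

    expectedWeight : Policy → ℝ
    expectedWeight π = 𝔼 (λ i → p (remQuot (|V| G) i)) (λ s → weight (output π (fromBits s)))

    -- A randomized algorithm draws its coins up front and then runs the resulting
    -- deterministic policy.  There are only finitely many valid policies, so taking a
    -- finite set of seeds loses no generality.
    record Algorithm : Set where
      field
        seeds  : ℕ
        prob   : Fin seeds → ℝ
        0≤prob : ∀ i → 0# ≤ prob i
        ∑prob  : sum prob ≡ 1#
        policy : Fin seeds → Policy
        valid  : ∀ i → Valid (policy i)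

      value : ℝ
      value = sum λ i → prob i * expectedWeight (policy i)

    -- Given the seed, the sequence of probes does not depend on the edge states; the
    -- decisions which active edges to put into the output still may.
    NonAdaptive : Algorithm → Set
    NonAdaptive A = ∀ i → ∃[ σ ] ∀ st → probes (policy i) st ≡ σ
      where open Algorithm A

    Achievable : Pred ℝ 0ℓ
    Achievable x = Σ[ A ∈ Algorithm ] x ≡ Algorithm.value A

    NonAdaptivelyAchievable : Pred ℝ 0ℓ
    NonAdaptivelyAchievable x = Σ[ A ∈ Algorithm ] NonAdaptive A × x ≡ Algorithm.value A

    totalWeight : ℝ
    totalWeight = sum λ u → sum λ v → w (u , v)

    private
      weight≤total : ∀ M → weight M ≤ totalWeight
      weight≤total M = sum-mono-≤ λ u → sum-mono-≤ λ v → entry u v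
        where
        entry : ∀ u v → (if does ((u , v) ∈? M) then w (u , v) else 0#) ≤ w (u , v)
        entry u v with does ((u , v) ∈? M)
        ... | true  = ≤-refl
        ... | false = 0≤w (u , v)

      convex : ∀ q c → q * c + (1# - q) * c ≡ c
      convex q c = trans (sym (distribʳ c q (1# - q)))
        (trans (cong (_* c) (trans (+-comm q (1# - q)) (x-y+y≡x 1# q))) (*-identityˡ c))

      𝔼≤ : ∀ {k} (q : Fin k → ℝ) f {c} → (∀ i → 0# ≤ q i) → (∀ i → q i ≤ 1#) →
           (∀ s → f s ≤ c) → 𝔼 q f ≤ c
      𝔼≤ {zero}  q f 0≤q q≤1 f≤c = f≤c _
      𝔼≤ {suc k} q f {c} 0≤q q≤1 f≤c = subst (_ ≤_) (convex (q zero) c) (+-mono-≤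
        (*-monoˡ-≤ (0≤q zero)
          (𝔼≤ (q ∘ suc) _ (0≤q ∘ suc) (q≤1 ∘ suc) λ _ → f≤c _))
        (*-monoˡ-≤ (x≤y⇒0≤y-x (q≤1 zero))
          (𝔼≤ (q ∘ suc) _ (0≤q ∘ suc) (q≤1 ∘ suc) λ _ → f≤c _)))

    value≤total : ∀ A → Algorithm.value A ≤ totalWeight
    value≤total A = subst (value ≤_)
      (trans (*-distribʳ-sum prob totalWeight)
             (trans (cong (_* totalWeight) ∑prob) (*-identityˡ totalWeight)))
      (sum-mono-≤ λ i → *-monoˡ-≤ (0≤prob i)
        (𝔼≤ (λ j → p (remQuot (|V| G) j)) _ (λ _ → 0≤p _) (λ _ → p≤1 _)
            λ s → weight≤total (output (policy i) (fromBits s))))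
      where open Algorithm A

    idle : SubstringClosed G → Algorithm
    idle closed = record
      { seeds  = 1
      ; prob   = λ _ → 1#
      ; 0≤prob = λ _ → 0≤1
      ; ∑prob  = CommutativeRing.+-identityʳ commutativeRing 1#
      ; policy = λ _ → stop
      ; valid  = λ _ → record
        { respects = λ _ v → closed v _ [] (here []) (proj₂ (𝒞-nonempty v))
        ; matching = λ _ → []
        }
      }

  open Probing

  -- Substring-closedness is used only to exhibit some algorithm.  Since there are
  -- finitely many valid policies, the supremum is a maximum.
  OPT : (G : StochasticGraph) → SubstringClosed G → ℝ
  OPT G closed = sup (Achievable G)
    (_ , idle G closed , refl)
    (totalWeight G , λ { _ (A , refl) → value≤total G A })

  OPTₙₐ : (G : StochasticGraph) → SubstringClosed G → ℝ
  OPTₙₐ G closed = sup (NonAdaptivelyAchievable G)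
    (_ , idle G closed , (λ _ → [] , λ _ → refl) , refl)
    (totalWeight G , λ { _ (A , _ , refl) → value≤total G A })

{-# OPTIONS --safe #-}

-- Lower bound.  Let x u v be the probability that (u , v) is in the output of an adaptive policy.
-- Seen from a single v, the policy is a mixture of strings in 𝒞 v with an accept/ignore label on
-- every edge, and the first active accepted edge is (u , v) with probability x u v.  So a
-- non-adaptive algorithm can let each v draw such a string independently and propose the edge found;
-- it remains to resolve contention at each u.  Every v gets a uniform slot i < N, and its proposal to
-- u is considered only with probability (1 - x u v / N) ^ i.  The other v′ then leave u free up to
-- slot i with probability ∏ (1 - x u v′ / N) ^ (i + 1); together with the thinning of v this is at
-- least (1 - 1/N) ^ (i + 1), and averaging over i yields (1 - 1/N) (1 - (1 - 1/N) ^ N) times the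
-- value of the policy.  The random strings and thinning are removed by conditional expectations,
-- because the value is affine in the distribution of each string.
--
-- Upper bound.  Take s² vertices u, s³ vertices v that may each probe one edge, and all edges active
-- with probability 1/s.  Probing one u until success matches s² - s vertices on average, whereas
-- splitting the v among the u in advance gives at most s² (1 - (1 - 1/s) ^ s) by concavity.

module Submission where

open import Defs
open import Algebra.Bundles using (CommutativeRing; RawRing)
open import Data.Bool using (Bool; true; false; if_then_else_; _∧_)
open import Data.Fin as Fin using (Fin; zero; suc; toℕ; remQuot; combine; _≟_)
import Data.Fin.Properties as Fin
open import Data.Integer as ℤ using (ℤ; -[1+_]; _⊖_; _◃_) renaming (+_ to pos)
import Data.Integer.Properties as ℤ
open import Data.List using (List; []; _∷_; _++_; map; filter; length; tabulate; allFin)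
import Data.List.Membership.DecPropositional as DecMembership
open import Data.List.Membership.Propositional using (_∈_)
open import Data.List.Membership.Propositional.Properties using (∈-filter⁺)
open import Data.List.Properties using
  (filter-++; filter-all; filter-none; filter-accept; filter-reject; ++-identityʳ; length-tabulate; ∷-injective)
open import Data.List.Relation.Binary.Infix.Heterogeneous using (here; there)
open import Data.List.Relation.Binary.Permutation.Propositional using
  (_↭_; prep; swap; ↭-refl; ↭-trans; ↭-sym; ↭⇒↭ₛ)
open import Data.List.Relation.Binary.Permutation.Setoid.Properties using (Unique-resp-↭)
open import Data.List.Relation.Binary.Prefix.Heterogeneous using ([]; _∷_)
open import Data.List.Relation.Unary.All as All using (All; []; _∷_)
open import Data.List.Relation.Unary.AllPairs as AllPairs using (AllPairs; []; _∷_)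
open import Data.List.Relation.Unary.Any using (here; there)
open import Data.List.Relation.Unary.Unique.Propositional using (Unique)
open import Data.List.Relation.Unary.Unique.Propositional.Properties using (allFin⁺)
open import Data.Maybe as Maybe using (Maybe; just; nothing)
open import Data.Nat as ℕ using (ℕ; zero; suc)
import Data.Nat.Properties as ℕ
open import Data.Product using (Σ-syntax; ∃; ∃-syntax; _×_; _,_; proj₁; proj₂; uncurry)
open import Data.Product.Properties using (≡-dec)
import Data.Sign as Sign
open import Data.Sum using (_⊎_; inj₁; inj₂)
open import Data.Unit using (⊤; tt)
open import Data.Vec.Functional using (updateAt) renaming (_∷_ to _∷ᶠ_)
open import Data.Vec.Functional.Properties using (updateAt-updates; updateAt-minimal)
open import Function using (_∘_; const; id)
open import Relation.Binary using (IsDecTotalOrder; Poset)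
open import Relation.Binary.Definitions using (DecidableEquality)
open import Relation.Binary.PropositionalEquality
import Relation.Binary.Reasoning.PartialOrder
open import Relation.Nullary using (Dec; does; yes; no; contradiction)
open import Relation.Nullary.Decidable using (dec-true; dec-false; dec⇒maybe)

-- The thinning is what lifts the constant above 1/2. Without it, with a uniform arrival time in
-- [0, 1], u is free at time t with probability ∏ (1 - t x u v′), which can be as small as 1 - t,
-- and the average over t is 1/2. Keeping an arrival at time t with probability e^(- t x) makes the
-- chance of a kept arrival by time t exactly 1 - e^(- t x); the product over v′ becomes the
-- exponential of a sum bounded by 1, and e^(- t) integrates to 1 - 1/e. Slots discretise this, with
-- powers of 1 - x / N for e^(- t x): only finite sums occur, and e enters only by comparing (1 -
-- 1/N) ^ N with its defining series. The price is the factor 1 - 1/N, caused by ties within a slot;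
-- it disappears as N grows.
--
-- In the extremal graph the expected number of successes, s³ / s, equals the number s² of vertices
-- u, so adaptivity loses only fluctuations of order s. A non-adaptive algorithm can afford s probes
-- per u on average, all of which fail with probability (1 - 1/s) ^ s.

-- Ring identities in the reals.

module ℤSolver (R : CompleteOrderedField) where
  open CompleteOrderedField R
  open CommutativeRing commutativeRing using (semiring; ring; +-comm; +-assoc; +-identityˡ; +-identityʳ; -‿inverseʳ; *-comm)
  open import Algebra.Properties.Semiring.Mult.TCOptimised semiring using (×-homo-+; ×1-homo-*; 1+×) renaming (_×_ to _·_)
  open import Algebra.Properties.Ring ring using (-‿+-comm; -‿involutive; -‿distribˡ-*; -‿distribʳ-*; -0#≈0#)
  open import Algebra.Solver.Ring.AlmostCommutativeRing using (fromCommutativeRing; _-Raw-AlmostCommutative⟶_)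

  private
    ℤ-rawRing : RawRing _ _
    ℤ-rawRing = record
      { Carrier = ℤ ; _≈_ = _≡_ ; _+_ = ℤ._+_ ; _*_ = ℤ._*_ ; -_ = ℤ.-_ ; 0# = pos 0 ; 1# = pos 1 }

    -- The optimised multiple makes `⟦ pos 1 ⟧` reduce to `1#`, so that solved equations match goals
    -- definitionally.
    ⟦_⟧ : ℤ → ℝ
    ⟦ pos n ⟧      = n · 1#
    ⟦ -[1+ n ] ⟧ = - (suc n · 1#)

    cancel : ∀ x y → (1# + x) - (1# + y) ≡ x - y
    cancel x y = begin
      (1# + x) + - (1# + y)      ≡⟨ cong₂ _+_ (+-comm 1# x) (sym (-‿+-comm 1# y)) ⟩
      (x + 1#) + (- 1# + - y)    ≡⟨ +-assoc x 1# _ ⟩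
      x + (1# + (- 1# + - y))    ≡⟨ cong (x +_) (sym (+-assoc 1# _ _)) ⟩
      x + ((1# + - 1#) + - y)    ≡⟨ cong (λ z → x + (z + - y)) (-‿inverseʳ 1#) ⟩
      x + (0# + - y)             ≡⟨ cong (x +_) (+-identityˡ _) ⟩
      x - y                      ∎
      where open ≡-Reasoning

    ⊖-homo : ∀ m n → ⟦ m ⊖ n ⟧ ≡ m · 1# - n · 1#
    ⊖-homo m zero = sym (trans (cong (m · 1# +_) -0#≈0#) (+-identityʳ _))
    ⊖-homo zero (suc n) = sym (+-identityˡ _)
    ⊖-homo (suc m) (suc n) = begin
      ⟦ suc m ⊖ suc n ⟧                    ≡⟨ cong ⟦_⟧ (ℤ.[1+m]⊖[1+n]≡m⊖n m n) ⟩
      ⟦ m ⊖ n ⟧                            ≡⟨ ⊖-homo m n ⟩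
      m · 1# - n · 1#                      ≡⟨ cancel _ _ ⟨
      (1# + m · 1#) - (1# + n · 1#)        ≡⟨ cong₂ _-_ (1+× m 1#) (1+× n 1#) ⟨
      suc m · 1# - suc n · 1#              ∎
      where open ≡-Reasoning

    +-homo : ∀ i j → ⟦ i ℤ.+ j ⟧ ≡ ⟦ i ⟧ + ⟦ j ⟧
    +-homo (pos m)      (pos n)      = ×-homo-+ 1# m n
    +-homo (pos m)      (-[1+ n ]) = ⊖-homo m (suc n)
    +-homo (-[1+ m ]) (pos n)      = trans (⊖-homo n (suc m)) (+-comm _ _)
    +-homo (-[1+ m ]) (-[1+ n ]) = trans
      (cong -_ (trans (cong (λ k → suc k · 1#) (sym (ℕ.+-suc m n))) (×-homo-+ 1# (suc m) (suc n))))
      (sym (-‿+-comm _ _))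

    +◃-homo : ∀ n → ⟦ Sign.+ ◃ n ⟧ ≡ n · 1#
    +◃-homo zero    = refl
    +◃-homo (suc n) = refl

    -◃-homo : ∀ n → ⟦ Sign.- ◃ n ⟧ ≡ - (n · 1#)
    -◃-homo zero    = sym -0#≈0#
    -◃-homo (suc n) = refl

    *-homo : ∀ i j → ⟦ i ℤ.* j ⟧ ≡ ⟦ i ⟧ * ⟦ j ⟧
    *-homo (pos m) (pos n) = trans (+◃-homo (m ℕ.* n)) (×1-homo-* m n)
    *-homo (pos m) (-[1+ n ]) = trans (-◃-homo (m ℕ.* suc n))
      (trans (cong -_ (×1-homo-* m (suc n))) (-‿distribʳ-* _ _))
    *-homo (-[1+ m ]) (pos n) = trans (-◃-homo (suc m ℕ.* n))
      (trans (cong -_ (×1-homo-* (suc m) n)) (-‿distribˡ-* _ _))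
    *-homo (-[1+ m ]) (-[1+ n ]) = trans (×1-homo-* (suc m) (suc n))
      (trans (sym (-‿involutive _)) (trans (cong -_ (-‿distribʳ-* _ _)) (-‿distribˡ-* _ _)))

    -‿homo : ∀ i → ⟦ ℤ.- i ⟧ ≡ - ⟦ i ⟧
    -‿homo (pos zero)   = sym -0#≈0#
    -‿homo (pos (suc n))  = refl
    -‿homo (-[1+ n ]) = sym (-‿involutive _)

    -- Integer coefficients have an equality that is decided by evaluation, so cancelling terms are
    -- recognised; equality on the abstract `ℝ` does not reduce.
    homomorphism : ℤ-rawRing -Raw-AlmostCommutative⟶ fromCommutativeRing commutativeRing
    homomorphism = record
      { ⟦_⟧ = ⟦_⟧ ; +-homo = +-homo ; *-homo = *-homo ; -‿homo = -‿homo
      ; 0-homo = refl ; 1-homo = refl }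

  open import Algebra.Solver.Ring _ _ homomorphism
    (λ i j → Maybe.map (cong ⟦_⟧) (dec⇒maybe (i ℤ.≟ j))) public
    using (solve; _:=_; _:+_; _:*_; _:-_; :-_; con; Polynomial)

  :0 :1 : ∀ {n} → Polynomial n
  :0 = con (pos 0)
  :1 = con (pos 1)

-- Inequalities, powers, finite sums and suprema in an ordered field.

module OrderedField (R : CompleteOrderedField) where
  open CompleteOrderedField R public
  open RealLemmas R public
  open ℤSolver R public
  open Euler R public
  open CommutativeRing commutativeRing public using
    (+-comm; +-assoc; +-identityˡ; +-identityʳ; -‿inverseˡ; -‿inverseʳ;
     *-identityˡ; *-identityʳ; *-comm; *-assoc; distribˡ; distribʳ; zeroˡ; zeroʳ; semiring)
  open import Algebra.Properties.Semiring.Exp semiring public using (_^_)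
  import Algebra.Properties.Semiring.Sum semiring as Sum

  ≤-poset : Poset _ _ _
  ≤-poset = record { isPartialOrder = IsDecTotalOrder.isPartialOrder isDecTotalOrder }

  module ≤-Reasoning = Relation.Binary.Reasoning.PartialOrder ≤-poset

  ≤-by : ∀ {x y d} → 0# ≤ d → x + d ≡ y → x ≤ y
  ≤-by {x} 0≤d eq = subst₂ _≤_ (+-identityʳ x) eq (+-monoʳ-≤ x 0≤d)

  *-monoʳ-≤ : ∀ {z x y} → 0# ≤ z → x ≤ y → x * z ≤ y * z
  *-monoʳ-≤ {z} {x} {y} 0≤z x≤y = subst₂ _≤_ (*-comm z x) (*-comm z y) (*-monoˡ-≤ 0≤z x≤y)

  *-mono-≤ : ∀ {x y u v} → 0# ≤ y → 0# ≤ u → x ≤ y → u ≤ v → x * u ≤ y * v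
  *-mono-≤ 0≤y 0≤u x≤y u≤v = ≤-trans (*-monoʳ-≤ 0≤u x≤y) (*-monoˡ-≤ 0≤y u≤v)

  x*x-nonneg : ∀ x → 0# ≤ x * x
  x*x-nonneg x with total 0# x
  ... | inj₁ 0≤x = *-nonneg 0≤x 0≤x
  ... | inj₂ x≤0 = subst (0# ≤_) (solve 1 (λ x → (:0 :- x) :* (:0 :- x) := x :* x) refl x)
                         (*-nonneg (x≤y⇒0≤y-x x≤0) (x≤y⇒0≤y-x x≤0))

  0≤1-x : ∀ {x} → x ≤ 1# → 0# ≤ 1# - x
  0≤1-x = x≤y⇒0≤y-x

  1-x≤1 : ∀ {x} → 0# ≤ x → 1# - x ≤ 1#
  1-x≤1 {x} 0≤x = ≤-by 0≤x (x-y+y≡x 1# x)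

  ^-nonneg : ∀ {x} n → 0# ≤ x → 0# ≤ x ^ n
  ^-nonneg zero    0≤x = 0≤1
  ^-nonneg (suc n) 0≤x = *-nonneg 0≤x (^-nonneg n 0≤x)

  1^n≡1 : ∀ n → 1# ^ n ≡ 1#
  1^n≡1 zero    = refl
  1^n≡1 (suc n) = trans (*-identityˡ _) (1^n≡1 n)

  ^-monoˡ-≤ : ∀ {x y} n → 0# ≤ x → x ≤ y → x ^ n ≤ y ^ n
  ^-monoˡ-≤ zero    0≤x x≤y = ≤-refl
  ^-monoˡ-≤ (suc n) 0≤x x≤y = *-mono-≤ (≤-trans 0≤x x≤y) (^-nonneg n 0≤x) x≤y (^-monoˡ-≤ n 0≤x x≤y)

  ^≤1 : ∀ {x} n → 0# ≤ x → x ≤ 1# → x ^ n ≤ 1#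
  ^≤1 {x} n 0≤x x≤1 = subst (x ^ n ≤_) (1^n≡1 n) (^-monoˡ-≤ n 0≤x x≤1)

  ^-distribʳ-* : ∀ x y n → (x * y) ^ n ≡ x ^ n * y ^ n
  ^-distribʳ-* x y zero    = sym (*-identityˡ 1#)
  ^-distribʳ-* x y (suc n) = trans (cong (x * y *_) (^-distribʳ-* x y n))
    (solve 4 (λ x y u v → x :* y :* (u :* v) := (x :* u) :* (y :* v)) refl x y (x ^ n) (y ^ n))

  -- The number k of summands is explicit because unification does not recover it from a sum.
  sum-cong : ∀ k {f g : Fin k → ℝ} → (∀ i → f i ≡ g i) → sum f ≡ sum g
  sum-cong k = Sum.sum-cong-≗

  sum-+ : ∀ k (f g : Fin k → ℝ) → sum (λ i → f i + g i) ≡ sum f + sum g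
  sum-+ k = Sum.∑-distrib-+

  sum-*ˡ : ∀ k c (f : Fin k → ℝ) → sum (λ i → c * f i) ≡ c * sum f
  sum-*ˡ k c f = sym (Sum.*-distribˡ-sum c f)

  sum-*ʳ : ∀ k (f : Fin k → ℝ) c → sum (λ i → f i * c) ≡ sum f * c
  sum-*ʳ k = *-distribʳ-sum

  sum-swap : ∀ k l (f : Fin k → Fin l → ℝ) → sum (λ i → sum (λ j → f i j)) ≡ sum (λ j → sum (λ i → f i j))
  sum-swap k l = Sum.∑-comm

  sum-zero : ∀ k {f : Fin k → ℝ} → (∀ i → f i ≡ 0#) → sum f ≡ 0#
  sum-zero k f≡0 = trans (sum-cong k f≡0) (Sum.sum-replicate-zero k)

  sum-mono : ∀ k {f g : Fin k → ℝ} → (∀ i → f i ≤ g i) → sum f ≤ sum g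
  sum-mono k = sum-mono-≤ {k}

  sum-const : ∀ k c → sum {k} (λ _ → c) ≡ fromℕ k * c
  sum-const zero    c = sym (zeroˡ c)
  sum-const (suc k) c = trans (cong (c +_) (sum-const k c))
    (solve 2 (λ n c → c :+ n :* c := (:1 :+ n) :* c) refl (fromℕ k) c)

  sum-nonneg : ∀ {k} {f : Fin k → ℝ} → (∀ i → 0# ≤ f i) → 0# ≤ sum {k} f
  sum-nonneg {zero}  0≤f = ≤-refl
  sum-nonneg {suc k} 0≤f = +-nonneg (0≤f zero) (sum-nonneg (0≤f ∘ suc))

  term≤sum : ∀ k {f : Fin k → ℝ} → (∀ i → 0# ≤ f i) → ∀ i → f i ≤ sum f
  term≤sum (suc k) 0≤f zero    = ≤-by (sum-nonneg (0≤f ∘ suc)) refl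
  term≤sum (suc k) 0≤f (suc i) = ≤-trans (term≤sum k (0≤f ∘ suc) i) (≤-by (0≤f zero) (+-comm _ _))

  0≤fromℕ : ∀ n → 0# ≤ fromℕ n
  0≤fromℕ zero    = ≤-refl
  0≤fromℕ (suc n) = +-nonneg 0≤1 (0≤fromℕ n)

  fromℕ≢0 : ∀ n → fromℕ (suc n) ≢ 0#
  fromℕ≢0 n eq = 1≢0 (antisym (≤-by (0≤fromℕ n) eq) 0≤1)

  ⁻¹-inverseˡ : ∀ x → x ≢ 0# → x ⁻¹ * x ≡ 1#
  ⁻¹-inverseˡ x x≢0 = trans (*-comm (x ⁻¹) x) (⁻¹-inverseʳ x x≢0)

  -- For positive `k` the number `k ⁻¹ * b` is an upper bound of `P`. For `k` zero there is nothing
  -- to invert, and an element of `P` supplies `0# ≤ b`.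
  *-sup-≤ : ∀ {P : ℝ → Set} {s k b} → IsSupremum P s → ∃ P → 0# ≤ k → (∀ x → P x → k * x ≤ b) → k * s ≤ b
  *-sup-≤ {P} {s} {k} {b} (_ , least) (x₀ , Px₀) 0≤k bounded with k ≤? 0#
  ... | yes k≤0 = subst (_≤ b) (trans (*0 x₀) (sym (*0 s))) (bounded x₀ Px₀)
    where
    *0 : ∀ y → k * y ≡ 0#
    *0 y = trans (cong (_* y) (antisym k≤0 0≤k)) (zeroˡ y)
  ... | no k≰0 = subst (k * s ≤_) (trans (sym (*-assoc k _ b)) (trans (cong (_* b) (⁻¹-inverseʳ k k≢0)) (*-identityˡ b)))
    (*-monoˡ-≤ 0≤k (least (k ⁻¹ * b) λ x Px → subst (_≤ k ⁻¹ * b)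
      (trans (sym (*-assoc _ k x)) (trans (cong (_* x) (⁻¹-inverseˡ k k≢0)) (*-identityˡ x)))
      (*-monoˡ-≤ (0≤⁻¹ 0≤k k≢0) (bounded x Px))))
    where
    k≢0 : k ≢ 0#
    k≢0 eq = k≰0 (≤-reflexive eq)

  -- The bounded multiples of `x - y` have a supremum `s`. They are closed under adding `x - y`, so
  -- `s - (x - y)` is an upper bound too, and leastness gives `x ≤ y`. This replaces every passage
  -- to a limit below.
  archimedean : ∀ {x y c} → (∀ n → (x - y) * fromℕ n ≤ c) → x ≤ y
  archimedean {x} {y} {c} bounded with x ≤? y
  ... | yes x≤y = x≤y
  ... | no  x≰y = contradiction (0≤y-x⇒x≤y 0≤y-x) x≰y
    where
    Multiple : ℝ → Set
    Multiple z = ∃[ n ] z ≡ (x - y) * fromℕ n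
    s-isSup : ∃ (IsSupremum Multiple)
    s-isSup = supremum Multiple (_ , 0 , refl) (c , λ { _ (n , refl) → bounded n })
    s : ℝ
    s = proj₁ s-isSup
    s≤s-[x-y] : s ≤ s - (x - y)
    s≤s-[x-y] = proj₂ (proj₂ s-isSup) _ λ { _ (n , refl) → ≤-trans
      (≤-reflexive (solve 3 (λ x y n → (x :- y) :* n := (x :- y) :* (:1 :+ n) :- (x :- y)) refl x y (fromℕ n)))
      (+-monoˡ-≤ (- (x - y)) (proj₁ (proj₂ s-isSup) _ (suc n , refl))) }
    0≤y-x : 0# ≤ y - x
    0≤y-x = subst (0# ≤_)
      (solve 3 (λ s x y → s :- (x :- y) :- s := y :- x) refl s x y)
      (x≤y⇒0≤y-x s≤s-[x-y])

-- Comparison of (1 - 1/N) ^ N with 1/e.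

module Exponential (R : CompleteOrderedField) where
  open OrderedField R

  0≤1/! : ∀ n → 0# ≤ 1/ n !
  0≤1/! zero    = 0≤1
  0≤1/! (suc n) = *-nonneg (0≤1/! n) (0≤⁻¹ (0≤fromℕ (suc n)) (fromℕ≢0 n))

  fromℕ*1/! : ∀ n → fromℕ (suc n) * 1/ suc n ! ≡ 1/ n !
  fromℕ*1/! n = begin
    fromℕ (suc n) * (1/ n ! * fromℕ (suc n) ⁻¹)
      ≡⟨ solve 3 (λ a b c → a :* (b :* c) := b :* (a :* c)) refl _ _ _ ⟩
    1/ n ! * (fromℕ (suc n) * fromℕ (suc n) ⁻¹)
      ≡⟨ cong (1/ n ! *_) (⁻¹-inverseʳ _ (fromℕ≢0 n)) ⟩
    1/ n ! * 1#
      ≡⟨ *-identityʳ _ ⟩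
    1/ n ! ∎
    where open ≡-Reasoning

  -- Partial sums of the exponential series; the derivative of each is the preceding one. They stand
  -- in for the exponential function, so that a supremum is taken only at the argument 1.
  taylor : ℕ → ℝ → ℝ
  taylor zero    x = 0#
  taylor (suc n) x = taylor n x + x ^ n * 1/ n !

  taylor[1]≡expSum : ∀ n → taylor n 1# ≡ expSum n
  taylor[1]≡expSum zero    = refl
  taylor[1]≡expSum (suc n) = cong₂ _+_ (taylor[1]≡expSum n) (trans (cong (_* 1/ n !) (1^n≡1 n)) (*-identityˡ _))

  taylor[0]≡1 : ∀ n → taylor (suc n) 0# ≡ 1#
  taylor[0]≡1 zero    = trans (+-identityˡ _) (*-identityˡ _)
  taylor[0]≡1 (suc n) = trans (cong₂ _+_ (taylor[0]≡1 n) (trans (cong (_* 1/ suc n !) (zeroˡ (0# ^ n))) (zeroˡ _))) (+-identityʳ _)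

  taylor-step : ∀ n {x} → 0# ≤ x → taylor n x ≤ taylor (suc n) x
  taylor-step n 0≤x = ≤-by (*-nonneg (^-nonneg n 0≤x) (0≤1/! n)) refl

  module _ {x a : ℝ} (0≤x : 0# ≤ x) (0≤a : 0# ≤ a) where
    private
      0≤x+a : 0# ≤ x + a
      0≤x+a = +-nonneg 0≤x 0≤a

    -- Together with `^-tangent-above` this is the mean value estimate for a power, whose derivative
    -- increases on nonnegative arguments: the increment lies between `a` times the derivatives at
    -- the two ends.
    ^-tangent-below : ∀ n → x ^ suc n + fromℕ (suc n) * a * x ^ n ≤ (x + a) ^ suc n
    ^-tangent-below zero = ≤-reflexive
      (solve 2 (λ x a → x :* :1 :+ (:1 :+ :0) :* a :* :1 := (x :+ a) :* :1) refl x a)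
    ^-tangent-below (suc n) = ≤-trans
      (≤-by (*-nonneg (*-nonneg (0≤fromℕ (suc n)) (*-nonneg 0≤a 0≤a)) (^-nonneg n 0≤x))
        (solve 4 (λ x a N p → x :* (x :* p) :+ (:1 :+ N) :* a :* (x :* p) :+ N :* (a :* a) :* p
                            := (x :+ a) :* (x :* p :+ N :* a :* p)) refl x a (fromℕ (suc n)) (x ^ n)))
      (*-monoˡ-≤ 0≤x+a (^-tangent-below n))

    ^-tangent-above : ∀ n → (x + a) ^ suc n ≤ x ^ suc n + fromℕ (suc n) * a * (x + a) ^ n
    ^-tangent-above zero = ≤-reflexive
      (solve 2 (λ x a → (x :+ a) :* :1 := x :* :1 :+ (:1 :+ :0) :* a :* :1) refl x a)
    ^-tangent-above (suc n) = ≤-trans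
      (≤-reflexive (distribʳ ((x + a) ^ suc n) x a))
      (≤-trans (+-monoˡ-≤ (a * (x + a) ^ suc n) (*-monoˡ-≤ 0≤x (^-tangent-above n)))
        (≤-by (*-nonneg (*-nonneg (0≤fromℕ (suc n)) (*-nonneg 0≤a 0≤a)) (^-nonneg n 0≤x+a))
          (solve 5 (λ x a N p q → x :* (x :* p :+ N :* a :* q) :+ a :* ((x :+ a) :* q) :+ N :* (a :* a) :* q
                      := x :* (x :* p) :+ (:1 :+ N) :* a :* ((x :+ a) :* q)) refl
             x a (fromℕ (suc n)) (x ^ n) ((x + a) ^ n))))

    -- The estimates for powers are summed term by term; `fromℕ*1/!` turns the derivative of each
    -- term into the preceding term.
    taylor-tangent-below : ∀ n → taylor (suc n) x + a * taylor n x ≤ taylor (suc n) (x + a)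
    taylor-tangent-below zero    = ≤-reflexive (solve 1 (λ a → :0 :+ :1 :* :1 :+ a :* :0 := :0 :+ :1 :* :1) refl a)
    taylor-tangent-below (suc n) = ≤-trans
      (≤-reflexive (trans
        (cong (λ z → taylor (suc n) x + x ^ suc n * 1/ suc n ! + a * (taylor n x + x ^ n * z)) (sym (fromℕ*1/! n)))
        (solve 7 (λ a t t′ p q N f → t :+ p :* f :+ a :* (t′ :+ q :* (N :* f))
                    := (t :+ a :* t′) :+ (p :+ N :* a :* q) :* f) refl
           a (taylor (suc n) x) (taylor n x) (x ^ suc n) (x ^ n) (fromℕ (suc n)) (1/ suc n !))))
      (+-mono-≤ (taylor-tangent-below n) (*-monoʳ-≤ (0≤1/! (suc n)) (^-tangent-below n)))

    taylor-tangent-above : ∀ n → taylor (suc n) (x + a) ≤ taylor (suc n) x + a * taylor n (x + a)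
    taylor-tangent-above zero    = ≤-reflexive (solve 1 (λ a → :0 :+ :1 :* :1 := :0 :+ :1 :* :1 :+ a :* :0) refl a)
    taylor-tangent-above (suc n) = ≤-trans
      (+-mono-≤ (taylor-tangent-above n) (*-monoʳ-≤ (0≤1/! (suc n)) (^-tangent-above n)))
      (≤-reflexive (trans
        (solve 7 (λ a t t′ p q N f → (t :+ a :* t′) :+ (p :+ N :* a :* q) :* f
                    := t :+ p :* f :+ a :* (t′ :+ q :* (N :* f))) refl
           a (taylor (suc n) x) (taylor n (x + a)) (x ^ suc n) ((x + a) ^ n) (fromℕ (suc n)) (1/ suc n !))
        (cong (λ z → taylor (suc n) x + x ^ suc n * 1/ suc n ! + a * (taylor n (x + a) + (x + a) ^ n * z)) (fromℕ*1/! n))))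

  module _ {a : ℝ} (0≤a : 0# ≤ a) where
    private
      0≤na : ∀ n → 0# ≤ fromℕ n * a
      0≤na n = *-nonneg (0≤fromℕ n) 0≤a

      na+a : ∀ n → fromℕ n * a + a ≡ fromℕ (suc n) * a
      na+a n = solve 2 (λ n a → n :* a :+ a := (:1 :+ n) :* a) refl (fromℕ n) a

    -- A finite form of (1 + a)^n ≤ e^(n a). One more factor `1# + a` is paid for by one tangent
    -- step, which costs one more term of the series.
    [1+a]^n≤taylor : ∀ n → (1# + a) ^ n ≤ taylor (suc n) (fromℕ n * a)
    [1+a]^n≤taylor zero    = ≤-reflexive (solve 0 (:1 := :0 :+ :1 :* :1) refl)
    [1+a]^n≤taylor (suc n) = ≤-trans (*-monoˡ-≤ (+-nonneg 0≤1 0≤a) ([1+a]^n≤taylor n))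
      (subst (λ z → (1# + a) * taylor (suc n) (fromℕ n * a) ≤ taylor (suc (suc n)) z) (na+a n)
        (≤-trans (≤-reflexive (solve 2 (λ a t → (:1 :+ a) :* t := t :+ a :* t) refl a _))
          (≤-trans (+-monoˡ-≤ _ (taylor-step (suc n) (0≤na n)))
                   (taylor-tangent-below (0≤na n) 0≤a (suc n)))))

    -- A finite form of (1 - a)^n e^(n a) ≤ 1. With T the polynomial, T (x + a) - T x is at most `a`
    -- times the derivative at x + a, hence at most a T (x + a); so each factor `1# - a` undoes one
    -- step of length `a`.
    [1-a]^n*taylor≤1 : a ≤ 1# → ∀ m n → (1# - a) ^ n * taylor (suc m) (fromℕ n * a) ≤ 1#
    [1-a]^n*taylor≤1 a≤1 m zero = ≤-reflexive
      (trans (*-identityˡ _) (trans (cong (taylor (suc m)) (zeroˡ a)) (taylor[0]≡1 m)))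
    [1-a]^n*taylor≤1 a≤1 m (suc n) = subst (λ z → (1# - a) ^ suc n * taylor (suc m) z ≤ 1#) (na+a n)
      (≤-trans (≤-reflexive (solve 3 (λ x p t → x :* p :* t := p :* (x :* t)) refl (1# - a) ((1# - a) ^ n) _))
        (≤-trans (*-monoˡ-≤ (^-nonneg n (0≤1-x a≤1)) step) ([1-a]^n*taylor≤1 a≤1 m n)))
      where
      na : ℝ
      na = fromℕ n * a
      step : (1# - a) * taylor (suc m) (na + a) ≤ taylor (suc m) na
      step = 0≤y-x⇒x≤y (subst (0# ≤_)
        (solve 4 (λ a t t′ t″ → (t :+ a :* t″ :- t′) :+ a :* (t′ :- t″) := t :- (:1 :- a) :* t′) refl
          a (taylor (suc m) na) (taylor (suc m) (na + a)) (taylor m (na + a)))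
        (+-nonneg (x≤y⇒0≤y-x (taylor-tangent-above (0≤na n) 0≤a m))
                  (*-nonneg 0≤a (x≤y⇒0≤y-x (taylor-step m (+-nonneg (0≤na n) 0≤a))))))

  private
    e-isSup : IsSupremum (λ x → ∃[ n ] x ≡ expSum n) e
    e-isSup = proj₂ (supremum _ _ _)

  expSum≤e : ∀ n → expSum n ≤ e
  expSum≤e n = proj₁ e-isSup _ (n , refl)

  1≤e : 1# ≤ e
  1≤e = subst (_≤ e) (+-identityˡ 1#) (expSum≤e 1)

  e≢0 : e ≢ 0#
  e≢0 eq = 1≢0 (antisym (subst (1# ≤_) eq 1≤e) 0≤1)

  0≤1/e : 0# ≤ 1# / e
  0≤1/e = *-nonneg 0≤1 (0≤⁻¹ (≤-trans 0≤1 1≤e) e≢0)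

  1/e*e≡1 : 1# / e * e ≡ 1#
  1/e*e≡1 = trans (cong (_* e) (*-identityˡ _)) (⁻¹-inverseˡ e e≢0)

  1/e≤1 : 1# / e ≤ 1#
  1/e≤1 = ≤-trans (≤-reflexive (sym (*-identityʳ _)))
    (≤-trans (*-monoˡ-≤ 0≤1/e 1≤e) (≤-reflexive 1/e*e≡1))

  *e≤1⇒≤1/e : ∀ {z} → z * e ≤ 1# → z ≤ 1# / e
  *e≤1⇒≤1/e {z} z*e≤1 = subst₂ _≤_ eq (*-identityˡ _) (*-monoʳ-≤ 0≤1/e z*e≤1)
    where
    eq : z * e * (1# / e) ≡ z
    eq = trans (trans (*-assoc z e _) (cong (z *_) (trans (*-comm e _) 1/e*e≡1))) (*-identityʳ z)

  1/1+_ : ℕ → ℝ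
  1/1+ n = fromℕ (suc n) ⁻¹

  0≤1/1+ : ∀ n → 0# ≤ 1/1+ n
  0≤1/1+ n = 0≤⁻¹ (0≤fromℕ (suc n)) (fromℕ≢0 n)

  [1+n]*1/1+n≡1 : ∀ n → fromℕ (suc n) * 1/1+ n ≡ 1#
  [1+n]*1/1+n≡1 n = ⁻¹-inverseʳ _ (fromℕ≢0 n)

  1/1+n≤1 : ∀ n → 1/1+ n ≤ 1#
  1/1+n≤1 n = ≤-by (*-nonneg (0≤fromℕ n) (0≤1/1+ n))
    (trans (solve 2 (λ n h → h :+ n :* h := (:1 :+ n) :* h) refl (fromℕ n) (1/1+ n)) ([1+n]*1/1+n≡1 n))

  -- With `a` the reciprocal of the exponent, the argument of `taylor` is 1. The bound holds for
  -- every partial sum of the series, hence for their supremum `e`.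
  [1-1/n]^n≤1/e : ∀ n → (1# - 1/1+ n) ^ suc n ≤ 1# / e
  [1-1/n]^n≤1/e n = *e≤1⇒≤1/e (*-sup-≤ e-isSup (_ , 0 , refl) 0≤z λ
    { _ (zero , refl) → ≤-trans (≤-reflexive (zeroʳ _)) 0≤1
    ; _ (suc m , refl) → subst (λ t → (1# - 1/1+ n) ^ suc n * t ≤ 1#)
        (trans (cong (taylor (suc m)) ([1+n]*1/1+n≡1 n)) (taylor[1]≡expSum (suc m)))
        ([1-a]^n*taylor≤1 (0≤1/1+ n) (1/1+n≤1 n) m (suc n)) })
    where
    0≤z : 0# ≤ (1# - 1/1+ n) ^ suc n
    0≤z = ^-nonneg (suc n) (0≤1-x (1/1+n≤1 n))

  -- The inverse of 1 - 1/(n + 2) is 1 + 1/(n + 1), whose power n + 1 is at most `e`. One factor `b`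
  -- is left over on both sides.
  [1-1/n]/e≤[1-1/n]^n : ∀ n → let b = 1# - 1/1+ (suc n) in b * (1# / e) ≤ b ^ suc (suc n)
  [1-1/n]/e≤[1-1/n]^n n = *-monoˡ-≤ 0≤b 1/e≤b^n
    where
    a h b N : ℝ
    a = 1/1+ n
    h = 1/1+ (suc n)
    b = 1# - h
    N = fromℕ (suc n)
    0≤b : 0# ≤ b
    0≤b = 0≤1-x (1/1+n≤1 (suc n))
    b[1+a]≡1 : b * (1# + a) ≡ 1#
    b[1+a]≡1 = begin
      (1# - h) * (1# + a)
        ≡⟨ solve 3 (λ a h N → (:1 :- h) :* (:1 :+ a)
                 := :1 :+ (a :- a :* ((:1 :+ N) :* h)) :+ (N :* a :* h :- h)) refl a h N ⟩
      1# + (a - a * ((1# + N) * h)) + (N * a * h - h)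
        ≡⟨ cong₂ (λ y z → 1# + (a - a * z) + (y * h - h)) ([1+n]*1/1+n≡1 n) ([1+n]*1/1+n≡1 (suc n)) ⟩
      1# + (a - a * 1#) + (1# * h - h)
        ≡⟨ solve 2 (λ a h → :1 :+ (a :- a :* :1) :+ (:1 :* h :- h) := :1) refl a h ⟩
      1# ∎
      where open ≡-Reasoning
    1≤b^n*e : 1# ≤ b ^ suc n * e
    1≤b^n*e = subst (_≤ b ^ suc n * e)
      (trans (sym (^-distribʳ-* b (1# + a) (suc n))) (trans (cong (_^ suc n) b[1+a]≡1) (1^n≡1 (suc n))))
      (*-monoˡ-≤ (^-nonneg (suc n) 0≤b)
        (≤-trans ([1+a]^n≤taylor (0≤1/1+ n) (suc n))
          (subst (_≤ e) (sym (trans (cong (taylor (suc (suc n))) ([1+n]*1/1+n≡1 n)) (taylor[1]≡expSum (suc (suc n)))))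
            (expSum≤e (suc (suc n))))))
    1/e≤b^n : 1# / e ≤ b ^ suc n
    1/e≤b^n = subst₂ _≤_ (*-identityˡ _)
      (trans (*-assoc _ e _) (trans (cong (b ^ suc n *_) (trans (*-comm e _) 1/e*e≡1)) (*-identityʳ _)))
      (*-monoʳ-≤ 0≤1/e 1≤b^n*e)

-- Expectations over independent bits.

module Expectation (R : CompleteOrderedField) where
  open OrderedField R
  open StochasticProbing R using (𝔼)

  sum-single : ∀ k {f : Fin k → ℝ} j → (∀ i → i ≢ j → f i ≡ 0#) → sum f ≡ f j
  sum-single (suc k) {f} zero    f≡0 =
    trans (cong (f zero +_) (sum-zero k λ i → f≡0 (suc i) λ ())) (+-identityʳ _)
  sum-single (suc k) {f} (suc j) f≡0 =
    trans (cong₂ _+_ (f≡0 zero λ ()) (sum-single k j λ i i≢j → f≡0 (suc i) (i≢j ∘ Fin.suc-injective)))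
          (+-identityˡ _)

  sum-single₂ : ∀ k l {f : Fin k → Fin l → ℝ} u v → (∀ i j → (i , j) ≢ (u , v) → f i j ≡ 0#) →
                sum (λ i → sum (λ j → f i j)) ≡ f u v
  sum-single₂ k l u v f≡0 = trans
    (sum-single k u λ i i≢u → sum-zero l λ j → f≡0 i j (i≢u ∘ cong proj₁))
    (sum-single l v λ j j≢v → f≡0 u j (j≢v ∘ cong proj₂))

  mix-const : ∀ q c → q * c + (1# - q) * c ≡ c
  mix-const = solve 2 (λ q c → q :* c :+ (:1 :- q) :* c := c) refl

  mix-mono-≤ : ∀ {q x x′ y y′} → 0# ≤ q → q ≤ 1# → x ≤ x′ → y ≤ y′ →
               q * x + (1# - q) * y ≤ q * x′ + (1# - q) * y′
  mix-mono-≤ 0≤q q≤1 x≤x′ y≤y′ = +-mono-≤ (*-monoˡ-≤ 0≤q x≤x′) (*-monoˡ-≤ (0≤1-x q≤1) y≤y′)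

  𝔼-cong : ∀ {k} (q : Fin k → ℝ) {f g} → (∀ s → f s ≡ g s) → 𝔼 q f ≡ 𝔼 q g
  𝔼-cong {zero}  q f≡g = f≡g _
  𝔼-cong {suc k} q f≡g = cong₂ (λ x y → q zero * x + (1# - q zero) * y)
    (𝔼-cong (q ∘ suc) λ _ → f≡g _) (𝔼-cong (q ∘ suc) λ _ → f≡g _)

  𝔼-const : ∀ {k} (q : Fin k → ℝ) c → 𝔼 q (λ _ → c) ≡ c
  𝔼-const {zero}  q c = refl
  𝔼-const {suc k} q c = trans
    (cong (λ x → q zero * x + (1# - q zero) * x) (𝔼-const (q ∘ suc) c)) (mix-const _ c)

  𝔼-+ˡ : ∀ {k} (q : Fin k → ℝ) c f → 𝔼 q (λ s → c + f s) ≡ c + 𝔼 q f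
  𝔼-+ˡ {zero}  q c f = refl
  𝔼-+ˡ {suc k} q c f = trans
    (cong₂ (λ x y → q zero * x + (1# - q zero) * y) (𝔼-+ˡ (q ∘ suc) c _) (𝔼-+ˡ (q ∘ suc) c _))
    (solve 4 (λ q c x y → q :* (c :+ x) :+ (:1 :- q) :* (c :+ y) := c :+ (q :* x :+ (:1 :- q) :* y)) refl _ c _ _)

  𝔼-mono-≤ : ∀ {k} (q : Fin k → ℝ) {f g} → (∀ i → 0# ≤ q i) → (∀ i → q i ≤ 1#) →
             (∀ s → f s ≤ g s) → 𝔼 q f ≤ 𝔼 q g
  𝔼-mono-≤ {zero}  q 0≤q q≤1 f≤g = f≤g _
  𝔼-mono-≤ {suc k} q 0≤q q≤1 f≤g = mix-mono-≤ (0≤q zero) (q≤1 zero)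
    (𝔼-mono-≤ (q ∘ suc) (0≤q ∘ suc) (q≤1 ∘ suc) λ _ → f≤g _)
    (𝔼-mono-≤ (q ∘ suc) (0≤q ∘ suc) (q≤1 ∘ suc) λ _ → f≤g _)

  -- Conditioning on an arbitrary bit. Both parts still average over all bits and overwrite bit `i`.
  -- The hypothesis on `f` is there because the bit vectors that arise are equal only pointwise.
  𝔼-split : ∀ {k} (q : Fin k → ℝ) f → (∀ s t → (∀ i → s i ≡ t i) → f s ≡ f t) → ∀ i →
            𝔼 q f ≡ q i * 𝔼 q (λ s → f (updateAt s i (const true)))
                  + (1# - q i) * 𝔼 q (λ s → f (updateAt s i (const false)))
  𝔼-split {suc k} q f ext zero = sym (cong₂ (λ x y → q zero * x + (1# - q zero) * y) (same true) (same false))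
    where
    same : ∀ b → 𝔼 q (λ s → f (updateAt s zero (const b))) ≡ 𝔼 (q ∘ suc) (λ s → f (b ∷ᶠ s))
    same b = trans
      (cong₂ (λ x y → q zero * x + (1# - q zero) * y)
        (𝔼-cong (q ∘ suc) λ s → ext _ _ λ { zero → refl ; (suc i) → refl })
        (𝔼-cong (q ∘ suc) λ s → ext _ _ λ { zero → refl ; (suc i) → refl }))
      (mix-const (q zero) _)
  𝔼-split {suc k} q f ext (suc i) = trans
    (cong₂ (λ x y → q zero * x + (1# - q zero) * y) (ih true) (ih false))
    (trans (solve 6 (λ p q a b c d → p :* (q :* a :+ (:1 :- q) :* b) :+ (:1 :- p) :* (q :* c :+ (:1 :- q) :* d)
        := q :* (p :* a :+ (:1 :- p) :* c) :+ (:1 :- q) :* (p :* b :+ (:1 :- p) :* d)) refl _ _ _ _ _ _)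
      (cong₂ (λ x y → q (suc i) * x + (1# - q (suc i)) * y)
        (cong₂ (λ x y → q zero * x + (1# - q zero) * y) (push true true) (push false true))
        (cong₂ (λ x y → q zero * x + (1# - q zero) * y) (push true false) (push false false))))
    where
    ih : ∀ b → _
    ih b = 𝔼-split (q ∘ suc) (λ s → f (b ∷ᶠ s))
      (λ s t s≗t → ext _ _ λ { zero → refl ; (suc i) → s≗t i }) i
    push : ∀ b c → 𝔼 (q ∘ suc) (λ s → f (b ∷ᶠ updateAt s i (const c)))
                 ≡ 𝔼 (q ∘ suc) (λ s → f (updateAt (b ∷ᶠ s) (suc i) (const c)))
    push b c = 𝔼-cong (q ∘ suc) λ s → ext _ _ λ { zero → refl ; (suc i) → refl }

-- The value of a policy as a linear functional.

module Policies (R : CompleteOrderedField) (G : StochasticProbing.StochasticGraph R) where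
  open OrderedField R
  open Expectation R public
  open StochasticProbing R
  open StochasticGraph G hiding (|U|; |V|)
  open Probing G

  nᵤ nᵥ : ℕ
  nᵤ = |U| G
  nᵥ = |V| G

  _≟ᴱ_ : DecidableEquality Edge
  _≟ᴱ_ = ≡-dec _≟_ _≟_

  open DecMembership _≟ᴱ_ using (_∈?_)

  at : Fin nᵥ → List Edge → List Edge
  at v = filter (λ e → proj₂ e ≟ v)

  infixl 9 _[_≔_]
  _[_≔_] : State → Edge → Bool → State
  (st [ e ≔ b ]) e′ = if does (e′ ≟ᴱ e) then b else st e′

  ≔-updates : ∀ st e b → (st [ e ≔ b ]) e ≡ b
  ≔-updates st e b = cong (if_then b else st e) (dec-true (e ≟ᴱ e) refl)

  ≔-minimal : ∀ st e b {e′} → e′ ≢ e → (st [ e ≔ b ]) e′ ≡ st e′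
  ≔-minimal st e b {e′} e′≢e = cong (if_then b else st e′) (dec-false (e′ ≟ᴱ e) e′≢e)

  run-cong : ∀ π st st′ → (∀ {e} → e ∈ probes π st → st e ≡ st′ e) →
             probes π st ≡ probes π st′ × output π st ≡ output π st′
  run-cong stop st st′ same = refl , refl
  run-cong (probe e a π₁ π₀) st st′ same
    with st e | st′ e | same (here refl) | (λ {e′} e′∈ → same {e′} (there e′∈))
  ... | true  | true  | refl | same′ = let eq₁ , eq₂ = run-cong π₁ st st′ same′ in
    cong (e ∷_) eq₁ , cong (λ M → if a then e ∷ M else M) eq₂
  ... | false | false | refl | same′ = let eq₁ , eq₂ = run-cong π₀ st st′ same′ in
    cong (e ∷_) eq₁ , eq₂

  -- A repeated probe would see the old outcome, whereas the recursion `Val` tosses a fresh coin at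
  -- every probe; without repetitions the two agree.
  ReadOnce : Policy → Set
  ReadOnce π = ∀ st → Unique (probes π st)

  branch : Bool → Policy → Policy → Policy
  branch b π₁ π₀ = if b then π₁ else π₀

  module _ {e : Edge} {a : Bool} {π₁ π₀ : Policy} (st : State) where
    probes-branch : ∀ b → st e ≡ b → probes (probe e a π₁ π₀) st ≡ e ∷ probes (branch b π₁ π₀) st
    probes-branch true  eq rewrite eq = refl
    probes-branch false eq rewrite eq = refl

    output-branch : ∀ b → st e ≡ b → output (probe e a π₁ π₀) st
      ≡ (if b ∧ a then e ∷ output (branch b π₁ π₀) st else output (branch b π₁ π₀) st)
    output-branch true  eq rewrite eq = refl
    output-branch false eq rewrite eq = refl

  module _ {e : Edge} {a : Bool} {π₁ π₀ : Policy} (once : ReadOnce (probe e a π₁ π₀)) (b : Bool) (st : State) where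
    private
      st′ = st [ e ≔ b ]
      π′  = branch b π₁ π₀
      probes-st′ : probes (probe e a π₁ π₀) st′ ≡ e ∷ probes π′ st′
      probes-st′ = probes-branch {e} {a} {π₁} {π₀} st′ b (≔-updates st e b)
      e∉ : All (e ≢_) (probes π′ st′)
      e∉ = AllPairs.head (subst Unique probes-st′ (once st′))
      same : probes π′ st′ ≡ probes π′ st × output π′ st′ ≡ output π′ st
      same = run-cong π′ st′ st λ e′∈ → ≔-minimal st e b λ { refl → All.lookup e∉ e′∈ refl }

    -- Forcing the state of `e` selects the branch and changes nothing afterwards, since `e` is not
    -- probed again.
    branch-probes : probes (probe e a π₁ π₀) st′ ≡ e ∷ probes π′ st
    branch-probes = trans probes-st′ (cong (e ∷_) (proj₁ same))

    branch-output : output (probe e a π₁ π₀) st′ ≡ (if b ∧ a then e ∷ output π′ st else output π′ st)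
    branch-output = trans (output-branch st′ b (≔-updates st e b))
                          (cong (λ M → if b ∧ a then e ∷ M else M) (proj₂ same))

  branch-readOnce : ∀ {e a π₁ π₀} → ReadOnce (probe e a π₁ π₀) → ∀ b → ReadOnce (branch b π₁ π₀)
  branch-readOnce {e} {a} {π₁} {π₀} once b st =
    AllPairs.tail (subst Unique (branch-probes {e} {a} {π₁} {π₀} once b st) (once (st [ e ≔ b ])))

  Matching : Policy → Set
  Matching π = ∀ st → IsMatching (output π st)

  branch-matching : ∀ {e a π₁ π₀} → ReadOnce (probe e a π₁ π₀) → Matching (probe e a π₁ π₀) →
                    ∀ b → Matching (branch b π₁ π₀)
  branch-matching {e} {a} {π₁} {π₀} once match b st =
    drop (b ∧ a) (subst IsMatching (branch-output {e} {a} {π₁} {π₀} once b st) (match (st [ e ≔ b ])))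
    where
    drop : ∀ c {M} → IsMatching (if c then e ∷ M else M) → IsMatching M
    drop true  = AllPairs.tail
    drop false m = m

  accepted-matching : ∀ {e π₁ π₀} → ReadOnce (probe e true π₁ π₀) → Matching (probe e true π₁ π₀) →
                      ∀ st → IsMatching (e ∷ output π₁ st)
  accepted-matching once match st = subst IsMatching (branch-output once true st) (match _)

  tally : (Edge → ℝ) → List Edge → ℝ
  tally f []      = 0#
  tally f (e ∷ M) = f e + tally f M

  -- For read-once policies this is the expected `f`-weight of the output (`E-output`). It is linear
  -- in `f`, so values, matching probabilities and the load of a single u are all instances.
  Val : (Edge → ℝ) → Policy → ℝ
  Val f stop              = 0#
  Val f (probe e a π₁ π₀) = p e * ((if a then f e else 0#) + Val f π₁) + (1# - p e) * Val f π₀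

  bias : Fin (nᵤ ℕ.* nᵥ) → ℝ
  bias i = p (remQuot nᵥ i)

  E[_] : (State → ℝ) → ℝ
  E[ f ] = 𝔼 bias (λ s → f (fromBits s))

  E-split : ∀ f → (∀ st st′ → (∀ e → st e ≡ st′ e) → f st ≡ f st′) → ∀ e →
            E[ f ] ≡ p e * E[ (λ st → f (st [ e ≔ true ])) ] + (1# - p e) * E[ (λ st → f (st [ e ≔ false ])) ]
  E-split f ext e@(u , v) = trans
    (𝔼-split bias (f ∘ fromBits) (λ s t s≗t → ext _ _ λ _ → s≗t _) (combine u v))
    (cong₂ _+_ (cong₂ _*_ p≡ (bits true)) (cong₂ _*_ (cong (λ z → 1# - z) p≡) (bits false)))
    where
    p≡ : p (remQuot nᵥ (combine u v)) ≡ p e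
    p≡ = cong p (Fin.remQuot-combine u v)
    agree : ∀ b s e′ → fromBits (updateAt s (combine u v) (const b)) e′ ≡ (fromBits s [ e ≔ b ]) e′
    agree b s e′@(u′ , v′) with e′ ≟ᴱ e
    ... | yes refl = updateAt-updates (combine u v) s
    ... | no e′≢e  = updateAt-minimal (combine u′ v′) (combine u v) s λ eq → e′≢e
      (trans (sym (Fin.remQuot-combine u′ v′)) (trans (cong (remQuot nᵥ) eq) (Fin.remQuot-combine u v)))
    bits : ∀ b → _
    bits b = 𝔼-cong bias λ s → ext _ _ (agree b s)

  E-output : ∀ f π → ReadOnce π → E[ (λ st → tally f (output π st)) ] ≡ Val f π
  E-output f stop once = 𝔼-const bias 0#
  E-output f π@(probe e a π₁ π₀) once = trans
    (E-split (λ st → tally f (output π st))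
      (λ st st′ st≗st′ → cong (tally f) (proj₂ (run-cong π st st′ λ _ → st≗st′ _))) e)
    (cong₂ (λ x y → p e * x + (1# - p e) * y)
      (trans (𝔼-cong bias λ s → trans (cong (tally f) (branch-output once true (fromBits s))) (accept s a))
        (trans (𝔼-+ˡ bias (if a then f e else 0#) _)
          (cong ((if a then f e else 0#) +_) (E-output f π₁ (branch-readOnce {e} {a} {π₁} {π₀} once true)))))
      (trans (𝔼-cong bias λ s → cong (tally f) (branch-output once false (fromBits s)))
        (E-output f π₀ (branch-readOnce {e} {a} {π₁} {π₀} once false))))
    where
    accept : ∀ s a → tally f (if a then e ∷ output π₁ (fromBits s) else output π₁ (fromBits s))
                   ≡ (if a then f e else 0#) + tally f (output π₁ (fromBits s))
    accept s true  = refl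
    accept s false = sym (+-identityˡ _)

  Val≤ : ∀ {f c} π → ReadOnce π → (∀ st → tally f (output π st) ≤ c) → Val f π ≤ c
  Val≤ {f} {c} π once bounded = subst₂ _≤_ (E-output f π once) (𝔼-const bias c)
    (𝔼-mono-≤ bias (λ _ → 0≤p _) (λ _ → p≤1 _) λ s → bounded (fromBits s))

  Val≡0 : ∀ {f} π → ReadOnce π → (∀ st → All (λ e → f e ≡ 0#) (output π st)) → Val f π ≡ 0#
  Val≡0 {f} π once vanish = trans (sym (E-output f π once))
    (trans (𝔼-cong bias λ s → tally≡0 (vanish (fromBits s))) (𝔼-const bias 0#))
    where
    tally≡0 : ∀ {M} → All (λ e → f e ≡ 0#) M → tally f M ≡ 0#
    tally≡0 []       = refl
    tally≡0 (x ∷ xs) = trans (cong₂ _+_ x (tally≡0 xs)) (+-identityˡ _)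

  Val-nonneg : ∀ {f} π → (∀ e → 0# ≤ f e) → 0# ≤ Val f π
  Val-nonneg stop              0≤f = ≤-refl
  Val-nonneg (probe e a π₁ π₀) 0≤f = +-nonneg
    (*-nonneg (0≤p e) (+-nonneg (accept a) (Val-nonneg π₁ 0≤f)))
    (*-nonneg (0≤1-x (p≤1 e)) (Val-nonneg π₀ 0≤f))
    where
    accept : ∀ a → 0# ≤ (if a then _ else 0#)
    accept true  = 0≤f e
    accept false = ≤-refl

  Val-cong : ∀ {f g} π → (∀ e → f e ≡ g e) → Val f π ≡ Val g π
  Val-cong stop f≡g = refl
  Val-cong (probe e a π₁ π₀) f≡g = cong₂ (λ x y → p e * x + (1# - p e) * y)
    (cong₂ _+_ (cong (if a then_else 0#) (f≡g e)) (Val-cong π₁ f≡g)) (Val-cong π₀ f≡g)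

  Val-*ˡ : ∀ c f π → Val (λ e → c * f e) π ≡ c * Val f π
  Val-*ˡ c f stop = sym (zeroʳ c)
  Val-*ˡ c f (probe e a π₁ π₀) = trans
    (cong₂ (λ x y → p e * x + (1# - p e) * y) (cong₂ _+_ (accept a) (Val-*ˡ c f π₁)) (Val-*ˡ c f π₀))
    (solve 5 (λ q c x y z → q :* (c :* x :+ c :* y) :+ (:1 :- q) :* (c :* z)
                         := c :* (q :* (x :+ y) :+ (:1 :- q) :* z)) refl _ c _ _ _)
    where
    accept : ∀ a → (if a then c * f e else 0#) ≡ c * (if a then f e else 0#)
    accept true  = refl
    accept false = sym (zeroʳ c)

  Val-+ : ∀ f g π → Val (λ e → f e + g e) π ≡ Val f π + Val g π
  Val-+ f g stop = sym (+-identityˡ 0#)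
  Val-+ f g (probe e a π₁ π₀) = trans
    (cong₂ (λ x y → p e * x + (1# - p e) * y) (cong₂ _+_ (accept a) (Val-+ f g π₁)) (Val-+ f g π₀))
    (solve 7 (λ q a b c d x y → q :* ((a :+ b) :+ (c :+ d)) :+ (:1 :- q) :* (x :+ y)
                := (q :* (a :+ c) :+ (:1 :- q) :* x) :+ (q :* (b :+ d) :+ (:1 :- q) :* y)) refl _ _ _ _ _ _ _)
    where
    accept : ∀ a → (if a then f e + g e else 0#) ≡ (if a then f e else 0#) + (if a then g e else 0#)
    accept true  = refl
    accept false = sym (+-identityˡ 0#)

  Val-sum : ∀ {k} (f : Fin k → Edge → ℝ) π → Val (λ e → sum λ i → f i e) π ≡ sum λ i → Val (f i) π
  Val-sum {zero} f π = zeros π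
    where
    zeros : ∀ π → Val (λ _ → 0#) π ≡ 0#
    zeros π = trans (Val-cong π λ _ → sym (zeroˡ 0#)) (trans (Val-*ˡ 0# (λ _ → 0#) π) (zeroˡ _))
  Val-sum {suc k} f π = trans (Val-+ (f zero) _ π) (cong (Val (f zero) π +_) (Val-sum (f ∘ suc) π))

  δ : Edge → Edge → ℝ
  δ e e′ = if does (e ≟ᴱ e′) then 1# else 0#

  -- By linearity a policy matters only through the probabilities of its output edges.
  Val-expand : ∀ c π → Val (uncurry c) π ≡ sum λ u → sum λ v → c u v * Val (δ (u , v)) π
  Val-expand c π = trans (Val-cong π λ e → sym (point e))
    (trans (Val-sum {nᵤ} (λ u e → sum λ v → c u v * δ (u , v) e) π)
      (sum-cong nᵤ λ u → trans (Val-sum {nᵥ} (λ v e → c u v * δ (u , v) e) π)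
        (sum-cong nᵥ λ v → Val-*ˡ (c u v) (δ (u , v)) π)))
    where
    point : ∀ e → (sum λ u → sum λ v → c u v * δ (u , v) e) ≡ uncurry c e
    point (u , v) = trans
      (sum-single₂ nᵤ nᵥ u v λ i j ≢ → trans
        (cong (λ b → c i j * (if b then 1# else 0#)) (dec-false ((i , j) ≟ᴱ (u , v)) ≢)) (zeroʳ _))
      (trans (cong (λ b → c u v * (if b then 1# else 0#)) (dec-true ((u , v) ≟ᴱ (u , v)) refl)) (*-identityʳ _))

  -- `weight` counts each member once and `tally` counts occurrences, so they agree in the absence
  -- of repetitions.
  weight≡tally : ∀ {M} → Unique M → weight M ≡ tally w M
  weight≡tally {[]} [] = sum-zero nᵤ λ u → sum-zero nᵥ λ v → refl
  weight≡tally {e@(u₀ , v₀) ∷ M} (e∉M ∷ uniq) = begin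
    weight (e ∷ M)
      ≡⟨ (sum-cong nᵤ λ u → trans (sum-cong nᵥ λ v → split (u , v)) (sum-+ nᵥ (head u) (tail u))) ⟩
    (sum λ u → sum (head u) + sum (tail u))
      ≡⟨ sum-+ nᵤ (λ u → sum (head u)) (λ u → sum (tail u)) ⟩
    (sum λ u → sum (head u)) + weight M
      ≡⟨ cong₂ _+_ at-e (weight≡tally uniq) ⟩
    w e + tally w M ∎
    where
    open ≡-Reasoning
    pick : ∀ {A : Set} → Dec A → ℝ → ℝ
    pick d c = if does d then c else 0#
    head tail : Fin nᵤ → Fin nᵥ → ℝ
    head u v = pick ((u , v) ≟ᴱ e) (w (u , v))
    tail u v = pick ((u , v) ∈? M) (w (u , v))
    at-e : (sum λ u → sum (head u)) ≡ w e
    at-e = trans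
      (sum-single₂ nᵤ nᵥ u₀ v₀ λ i j ≢ → cong (if_then w (i , j) else 0#) (dec-false ((i , j) ≟ᴱ e) ≢))
      (cong (if_then w e else 0#) (dec-true (e ≟ᴱ e) refl))
    split : ∀ e′ → pick (e′ ∈? (e ∷ M)) (w e′) ≡ pick (e′ ≟ᴱ e) (w e′) + pick (e′ ∈? M) (w e′)
    split e′ with e′ ≟ᴱ e
    ... | no  _    = sym (+-identityˡ _)
    ... | yes refl = sym (trans
      (cong (λ b → w e + (if b then w e else 0#)) (dec-false (e ∈? M) λ e∈M → All.lookup e∉M e∈M refl))
      (+-identityʳ _))

  -- Two occurrences of an edge would both remain in the sublist of its own v. Hence valid policies
  -- are read-once.
  unique-of-at : ∀ {l} → (∀ v → Unique (at v l)) → Unique l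
  unique-of-at {[]}    uniq = []
  unique-of-at {e ∷ l} uniq = All.tabulate (λ { e∈l refl → All.lookup (AllPairs.head here-uniq)
                                (∈-filter⁺ (λ e′ → proj₂ e′ ≟ proj₂ e) e∈l refl) refl })
                            ∷ unique-of-at tail-uniq
    where
    here-uniq : Unique (e ∷ at (proj₂ e) l)
    here-uniq = subst Unique (filter-accept (λ e′ → proj₂ e′ ≟ proj₂ e) refl) (uniq (proj₂ e))
    tail-uniq : ∀ v → Unique (at v l)
    tail-uniq v with proj₂ e ≟ v | uniq v
    ... | yes _ | u = AllPairs.tail u
    ... | no  _ | u = u

  valid-readOnce : ∀ {π} → Valid π → ReadOnce π
  valid-readOnce valid st = unique-of-at λ v → 𝒞-distinct v _ (Valid.respects valid st v)

  matching-unique : ∀ {M} → IsMatching M → Unique M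
  matching-unique = AllPairs.map λ { (u≢u′ , _) refl → u≢u′ refl }

  expectedWeight≡Val : ∀ {π} → Valid π → expectedWeight π ≡ Val w π
  expectedWeight≡Val {π} valid = trans
    (𝔼-cong bias λ s → weight≡tally (matching-unique (Valid.matching valid (fromBits s))))
    (E-output w π (valid-readOnce valid))

  row : Fin nᵤ → Edge → ℝ
  row u e = if does (proj₁ e ≟ u) then 1# else 0#

  Val-row≤1 : ∀ u π → ReadOnce π → Matching π → Val (row u) π ≤ 1#
  Val-row≤1 u π once match = Val≤ π once λ st → bound (match st)
    where
    none : ∀ {M} → All (λ e → u ≢ proj₁ e) M → tally (row u) M ≡ 0#
    none []       = refl
    none (≢ ∷ ≢s) = trans
      (cong₂ (λ b x → (if b then 1# else 0#) + x) (dec-false (_ ≟ u) (≢ ∘ sym)) (none ≢s)) (+-identityˡ _)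
    bound : ∀ {M} → IsMatching M → tally (row u) M ≤ 1#
    bound [] = 0≤1
    bound {(u′ , _) ∷ M} (disj ∷ m) with u′ ≟ u
    ... | yes refl = ≤-reflexive (trans (cong (1# +_) (none (All.map proj₁ disj))) (+-identityʳ 1#))
    ... | no  _    = subst (_≤ 1#) (sym (+-identityˡ _)) (bound m)

  sum-row : ∀ (β : Fin nᵤ → ℝ) e → sum (λ u → β u * row u e) ≡ β (proj₁ e)
  sum-row β (u , v) = trans
    (sum-single nᵤ u λ i i≢u → trans
      (cong (λ b → β i * (if b then 1# else 0#)) (dec-false (u ≟ i) (i≢u ∘ sym))) (zeroʳ (β i)))
    (trans (cong (λ b → β u * (if b then 1# else 0#)) (dec-true (u ≟ u) refl)) (*-identityʳ (β u)))

  deterministic : ∀ {π} → Valid π → Algorithm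
  deterministic {π} valid = record
    { seeds = 1 ; prob = λ _ → 1# ; 0≤prob = λ _ → 0≤1 ; ∑prob = +-identityʳ 1#
    ; policy = λ _ → π ; valid = λ _ → valid }

  deterministic-value : ∀ {π} (valid : Valid π) → Algorithm.value (deterministic valid) ≡ Val w π
  deterministic-value valid = trans (+-identityʳ _) (trans (*-identityˡ _) (expectedWeight≡Val valid))

  Val-rows : ∀ π → Val w π ≡ sum λ u → Val (λ e → row u e * w e) π
  Val-rows π = trans
    (Val-cong π λ e → sym (trans (sum-*ʳ nᵤ (λ u → row u e) (w e))
      (trans (cong (_* w e) (trans (sum-cong nᵤ λ u → sym (*-identityˡ (row u e))) (sum-row (λ _ → 1#) e))) (*-identityˡ _))))
    (Val-sum {nᵤ} (λ u e → row u e * w e) π)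

-- Contention resolution with random slots.

module RandomSchedule (R : CompleteOrderedField) where
  open OrderedField R
  open Expectation R

  suc-≤? : ∀ {N} (i j : Fin N) → does (suc i Fin.≤? suc j) ≡ does (i Fin.≤? j)
  suc-≤? zero    j = refl
  suc-≤? (suc i) j = refl

  -- The terms telescope: y (1 - y)^i is the difference of two consecutive powers of 1 - y.
  survival : ∀ {N} y (j : Fin N) →
    sum {N} (λ i → if does (i Fin.≤? j) then y * (1# - y) ^ toℕ i else 0#) ≡ 1# - (1# - y) ^ suc (toℕ j)
  survival {suc N} y zero = begin
    y * 1# + sum {N} (λ i → 0#)   ≡⟨ cong (y * 1# +_) (sum-zero N λ i → refl) ⟩
    y * 1# + 0#                   ≡⟨ solve 1 (λ y → y :* :1 :+ :0 := :1 :- (:1 :- y) :* :1) refl y ⟩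
    1# - (1# - y) * 1#            ∎
    where open ≡-Reasoning
  survival {suc N} y (suc j) = begin
    y * 1# + sum {N} (λ i → if does (suc i Fin.≤? suc j) then y * (1# - y) ^ toℕ (suc i) else 0#)
      ≡⟨ cong (y * 1# +_) (sum-cong N shift) ⟩
    y * 1# + sum {N} (λ i → (1# - y) * term i)
      ≡⟨ cong (y * 1# +_) (sum-*ˡ N (1# - y) term) ⟩
    y * 1# + (1# - y) * sum {N} term
      ≡⟨ cong (λ z → y * 1# + (1# - y) * z) (survival {N} y j) ⟩
    y * 1# + (1# - y) * (1# - (1# - y) ^ suc (toℕ j))
      ≡⟨ solve 2 (λ y z → y :* :1 :+ (:1 :- y) :* (:1 :- z) := :1 :- (:1 :- y) :* z) refl y _ ⟩
    1# - (1# - y) ^ suc (toℕ (suc j)) ∎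
    where
    open ≡-Reasoning
    term : Fin N → ℝ
    term i = if does (i Fin.≤? j) then y * (1# - y) ^ toℕ i else 0#
    shift : ∀ i → (if does (suc i Fin.≤? suc j) then y * (1# - y) ^ toℕ (suc i) else 0#) ≡ (1# - y) * term i
    shift i rewrite suc-≤? i j with does (i Fin.≤? j)
    ... | true  = solve 3 (λ y z p → y :* (z :* p) := z :* (y :* p)) refl y _ _
    ... | false = sym (zeroʳ _)

  -- The exponent i + 1 instead of i, which is the cost of ties, produces the leading factor
  -- `1# - h`.
  geometric : ∀ N h → sum {N} (λ i → h * (1# - h) ^ suc (toℕ i)) ≡ (1# - h) * (1# - (1# - h) ^ N)
  geometric zero    h = solve 1 (λ b → :0 := b :* (:1 :- :1)) refl (1# - h)
  geometric (suc N) h = begin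
    h * ((1# - h) * 1#) + sum {N} (λ i → h * (1# - h) ^ suc (toℕ (suc i)))
      ≡⟨ cong (h * ((1# - h) * 1#) +_) (sum-cong N λ i →
           solve 3 (λ h b p → h :* (b :* p) := b :* (h :* p)) refl h (1# - h) ((1# - h) ^ suc (toℕ i))) ⟩
    h * ((1# - h) * 1#) + sum {N} (λ i → (1# - h) * term i)
      ≡⟨ cong (h * ((1# - h) * 1#) +_) (sum-*ˡ N (1# - h) term) ⟩
    h * ((1# - h) * 1#) + (1# - h) * sum {N} term
      ≡⟨ cong (λ z → h * ((1# - h) * 1#) + (1# - h) * z) (geometric N h) ⟩
    h * ((1# - h) * 1#) + (1# - h) * ((1# - h) * (1# - (1# - h) ^ N))
      ≡⟨ solve 2 (λ h p → h :* ((:1 :- h) :* :1) :+ (:1 :- h) :* ((:1 :- h) :* (:1 :- p))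
                    := (:1 :- h) :* (:1 :- (:1 :- h) :* p)) refl h ((1# - h) ^ N) ⟩
    (1# - h) * (1# - (1# - h) ^ suc N) ∎
    where
    open ≡-Reasoning
    term : Fin N → ℝ
    term i = h * (1# - h) ^ suc (toℕ i)

  -- Each vertex picks one of N equiprobable time slots; they are processed by increasing slot.
  module Slots (V : Set) (N : ℕ) (h : ℝ) (0≤h : 0# ≤ h) (N*h≡1 : sum {N} (λ _ → h) ≡ 1#) where

    Schedule : Set
    Schedule = List (V × Fin N)

    Sorted : Schedule → Set
    Sorted = AllPairs λ a b → proj₂ a Fin.≤ proj₂ b

    insert : V × Fin N → Schedule → Schedule
    insert a []      = a ∷ []
    insert a (b ∷ J) with proj₂ a Fin.≤? proj₂ b
    ... | yes _ = a ∷ b ∷ J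
    ... | no  _ = b ∷ insert a J

    insert-↭ : ∀ a J → map proj₁ (insert a J) ↭ proj₁ a ∷ map proj₁ J
    insert-↭ a []      = ↭-refl
    insert-↭ a (b ∷ J) with proj₂ a Fin.≤? proj₂ b
    ... | yes _ = ↭-refl
    ... | no  _ = ↭-trans (prep _ (insert-↭ a J)) (swap _ _ ↭-refl)

    insert-all : ∀ {Q : V × Fin N → Set} {a J} → Q a → All Q J → All Q (insert a J)
    insert-all qa [] = qa ∷ []
    insert-all {a = a} {b ∷ J} qa (qb ∷ qJ) with proj₂ a Fin.≤? proj₂ b
    ... | yes _ = qa ∷ qb ∷ qJ
    ... | no  _ = qb ∷ insert-all qa qJ

    insert-sorted : ∀ a {J} → Sorted J → Sorted (insert a J)
    insert-sorted a [] = [] ∷ []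
    insert-sorted a {b ∷ J} (b≤J ∷ sorted) with proj₂ a Fin.≤? proj₂ b
    ... | yes a≤b = (a≤b ∷ All.map (Fin.≤-trans a≤b) b≤J) ∷ b≤J ∷ sorted
    ... | no  a≰b = insert-all (ℕ.≰⇒≥ a≰b) b≤J ∷ insert-sorted a sorted

    -- Schedules are built by insertion, so that inductions on the vertex list can detach one vertex
    -- and keep a sorted schedule of the others.
    average : List V → (Schedule → ℝ) → ℝ
    average []      f = f []
    average (v ∷ l) f = sum {N} λ i → h * average l (λ J → f (insert (v , i) J))

    average-mono-≤ : ∀ l {f g} → (∀ J → Sorted J → map proj₁ J ↭ l → f J ≤ g J) → average l f ≤ average l g
    average-mono-≤ []      f≤g = f≤g [] [] ↭-refl
    average-mono-≤ (v ∷ l) f≤g = sum-mono N λ i → *-monoˡ-≤ 0≤h (average-mono-≤ l λ J sorted J↭l →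
      f≤g _ (insert-sorted (v , i) sorted) (↭-trans (insert-↭ (v , i) J) (prep v J↭l)))

    average-cong : ∀ l {f g} → (∀ J → f J ≡ g J) → average l f ≡ average l g
    average-cong []      f≡g = f≡g []
    average-cong (v ∷ l) f≡g = sum-cong N λ i → cong (h *_) (average-cong l λ J → f≡g _)

    average-const : ∀ l c → average l (λ _ → c) ≡ c
    average-const []      c = refl
    average-const (v ∷ l) c = trans (sum-cong N λ i → cong (h *_) (average-const l c))
      (trans (sum-*ʳ N (λ _ → h) c) (trans (cong (_* c) N*h≡1) (*-identityˡ c)))

    average-*ˡ : ∀ l c f → average l (λ J → c * f J) ≡ c * average l f
    average-*ˡ []      c f = refl
    average-*ˡ (v ∷ l) c f = trans
      (sum-cong N λ i → trans (cong (h *_) (average-*ˡ l c _))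
        (solve 3 (λ h c x → h :* (c :* x) := c :* (h :* x)) refl h c _))
      ((sum-*ˡ N c _))

    average-+ : ∀ l f g → average l (λ J → f J + g J) ≡ average l f + average l g
    average-+ []      f g = refl
    average-+ (v ∷ l) f g = trans
      (sum-cong N λ i → trans (cong (h *_) (average-+ l _ _)) (distribˡ h _ _))
      (sum-+ N _ _)

    average-sum : ∀ l {k} (f : Fin k → Schedule → ℝ) →
                  average l (λ J → sum λ u → f u J) ≡ sum λ u → average l (f u)
    average-sum l {zero}  f = average-const l 0#
    average-sum l {suc k} f = trans (average-+ l (f zero) _) (cong (average l (f zero) +_) (average-sum l (f ∘ suc)))

    sumᴸ : (V → ℝ) → List V → ℝ
    sumᴸ f []      = 0#
    sumᴸ f (v ∷ l) = f v + sumᴸ f l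

    sumᴸ-tabulate : ∀ {n} f (g : Fin n → V) → sumᴸ f (tabulate g) ≡ sum (f ∘ g)
    sumᴸ-tabulate {zero}  f g = refl
    sumᴸ-tabulate {suc n} f g = cong (f (g zero) +_) (sumᴸ-tabulate f (g ∘ suc))

    -- Contention for a single item.

    module Contention (W x : V → ℝ) (0≤W : ∀ v → 0# ≤ W v) (0≤x : ∀ v → 0# ≤ x v) (x≤1 : ∀ v → x v ≤ 1#)
                      (h≤1 : h ≤ 1#) where

      survive : V → ℝ
      survive v = 1# - h * x v

      0≤hx : ∀ v → 0# ≤ h * x v
      0≤hx v = *-nonneg 0≤h (0≤x v)

      0≤survive : ∀ v → 0# ≤ survive v
      0≤survive v = 0≤1-x (≤-trans (*-mono-≤ 0≤1 (0≤x v) h≤1 (x≤1 v)) (≤-reflexive (*-identityˡ 1#)))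

      survive≤1 : ∀ v → survive v ≤ 1#
      survive≤1 v = 1-x≤1 (0≤hx v)

      -- The chance x v, thinned so that a vertex with a random slot is inactive or arrives after
      -- slot j with probability exactly survive v ^ (j + 1).
      Y : V → Fin N → ℝ
      Y v i = survive v ^ toℕ i * x v

      0≤Y : ∀ v i → 0# ≤ Y v i
      0≤Y v i = *-nonneg (^-nonneg (toℕ i) (0≤survive v)) (0≤x v)

      Y≤1 : ∀ v i → Y v i ≤ 1#
      Y≤1 v i = ≤-trans (*-mono-≤ 0≤1 (0≤x v) (^≤1 (toℕ i) (0≤survive v) (survive≤1 v)) (x≤1 v))
                        (≤-reflexive (*-identityˡ 1#))

      -- φ i is the chance that the vertices outside the schedule leave the item free until slot i.
      reward : (Fin N → ℝ) → Schedule → ℝ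
      reward φ []            = 0#
      reward φ ((v , i) ∷ J) = φ i * (W v * Y v i) + (1# - Y v i) * reward φ J

      -- An arrival in slot `j` itself counts as blocking slot `j`, however the tie is broken. This
      -- makes the factor independent of the order inside a slot.
      factor : V → Fin N → Fin N → ℝ
      factor v i j = if does (i Fin.≤? j) then 1# - Y v i else 1#

      0≤factor : ∀ v i j → 0# ≤ factor v i j
      0≤factor v i j with does (i Fin.≤? j)
      ... | true  = 0≤1-x (Y≤1 v i)
      ... | false = 0≤1

      factor≤1 : ∀ v i j → factor v i j ≤ 1#
      factor≤1 v i j with does (i Fin.≤? j)
      ... | true  = 1-x≤1 (0≤Y v i)
      ... | false = ≤-refl

      free : Fin N → Schedule → ℝ
      free j []            = 1#
      free j ((v , i) ∷ J) = factor v i j * free j J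

      0≤free : ∀ j J → 0# ≤ free j J
      0≤free j []            = 0≤1
      0≤free j ((v , i) ∷ J) = *-nonneg (0≤factor v i j) (0≤free j J)

      free≤1 : ∀ j J → free j J ≤ 1#
      free≤1 j []            = ≤-refl
      free≤1 j ((v , i) ∷ J) = ≤-trans
        (*-mono-≤ 0≤1 (0≤free j J) (factor≤1 v i j) (free≤1 j J)) (≤-reflexive (*-identityˡ 1#))

      free-insert : ∀ j v i J → free j (insert (v , i) J) ≡ factor v i j * free j J
      free-insert j v i [] = refl
      free-insert j v i ((v′ , i′) ∷ J) with i Fin.≤? i′
      ... | yes _ = refl
      ... | no  _ = trans (cong (factor v′ i′ j *_) (free-insert j v i J))
        (solve 3 (λ a b c → a :* (b :* c) := b :* (a :* c)) refl _ _ _)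

      discounted : (Fin N → ℝ) → V → Fin N → Fin N → ℝ
      discounted φ v i j = φ j * factor v i j

      reward-later : ∀ φ v i {J} → All (λ a → i Fin.≤ proj₂ a) J →
                     reward (discounted φ v i) J ≡ (1# - Y v i) * reward φ J
      reward-later φ v i [] = sym (zeroʳ _)
      reward-later φ v i {(v′ , j) ∷ J} (i≤j ∷ i≤J)
        rewrite dec-true (i Fin.≤? j) i≤j | reward-later φ v i i≤J =
        solve 5 (λ p y r y′ z → p :* y :* r :+ y′ :* (y :* z) := y :* (p :* r :+ y′ :* z)) refl _ _ _ _ _

      -- The reward splits into the part of `v`, damped by the arrivals up to slot `i`, and the part
      -- of the others, where the blocking by `v` moves into φ. Equality can fail only through ties:
      -- `free i J` also charges the entries of slot `i` that come after `v`.
      reward-insert : ∀ φ v i {J} → (∀ j → 0# ≤ φ j) → Sorted J →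
        φ i * (W v * Y v i) * free i J + reward (discounted φ v i) J ≤ reward φ (insert (v , i) J)
      reward-insert φ v i 0≤φ [] = ≤-reflexive
        (solve 2 (λ a y → a :* :1 :+ :0 := a :+ (:1 :- y) :* :0) refl _ (Y v i))
      reward-insert φ v i {(v′ , j) ∷ J} 0≤φ (j≤J ∷ sorted) with i Fin.≤? j
      ... | yes i≤j = +-mono-≤
        (≤-trans (*-monoˡ-≤ (*-nonneg (0≤φ i) (*-nonneg (0≤W v) (0≤Y v i))) (free≤1 i ((v′ , j) ∷ J)))
                 (≤-reflexive (*-identityʳ _)))
        (≤-reflexive (reward-later φ v i {(v′ , j) ∷ J} (i≤j ∷ All.map (Fin.≤-trans i≤j) j≤J)))
      ... | no  i≰j rewrite dec-true (j Fin.≤? i) (ℕ.≰⇒≥ i≰j) | dec-false (i Fin.≤? j) i≰j = ≤-trans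
        (≤-reflexive (solve 6 (λ a y f p b r →
             a :* (y :* f) :+ (p :* :1 :* b :+ y :* r)
             := p :* b :+ y :* (a :* f :+ r)) refl _ _ _ _ _ _))
        (+-monoʳ-≤ _ (*-monoˡ-≤ (0≤1-x (Y≤1 v′ j)) (reward-insert φ v i 0≤φ sorted)))

      -- The thinning is chosen for this: since h x = 1 - survive, the averaged blocking
      -- probabilities telescope to a pure power, and powers of different vertices with a common
      -- exponent multiply.
      average-factor : ∀ v j → sum {N} (λ i → h * factor v i j) ≡ survive v ^ suc (toℕ j)
      average-factor v j = begin
        sum {N} (λ i → h * factor v i j)
          ≡⟨ sum-cong N split ⟩
        sum {N} (λ i → h + - 1# * (if does (i Fin.≤? j) then h * x v * survive v ^ toℕ i else 0#))
          ≡⟨ sum-+ N (λ _ → h) (λ i → - 1# * (if does (i Fin.≤? j) then h * x v * survive v ^ toℕ i else 0#)) ⟩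
        sum {N} (λ _ → h) + sum {N} (λ i → - 1# * (if does (i Fin.≤? j) then h * x v * survive v ^ toℕ i else 0#))
          ≡⟨ cong₂ _+_ N*h≡1 (trans ((sum-*ˡ N (- 1#) _)) (cong (- 1# *_) (survival (h * x v) j))) ⟩
        1# + - 1# * (1# - survive v ^ suc (toℕ j))
          ≡⟨ solve 1 (λ z → :1 :+ :- :1 :* (:1 :- z) := z) refl _ ⟩
        survive v ^ suc (toℕ j) ∎
        where
        open ≡-Reasoning
        split : ∀ i → h * factor v i j
                    ≡ h + - 1# * (if does (i Fin.≤? j) then h * x v * survive v ^ toℕ i else 0#)
        split i with does (i Fin.≤? j)
        ... | true  = solve 3 (λ h x p → h :* (:1 :- p :* x) := h :+ :- :1 :* (h :* x :* p)) refl h (x v) _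
        ... | false = solve 1 (λ h → h :* :1 := h :+ :- :1 :* :0) refl h

      D : List V → ℝ
      D []      = 1#
      D (v ∷ l) = survive v * D l

      0≤D : ∀ l → 0# ≤ D l
      0≤D []      = 0≤1
      0≤D (v ∷ l) = *-nonneg (0≤survive v) (0≤D l)

      average-free : ∀ l j → average l (free j) ≡ D l ^ suc (toℕ j)
      average-free []      j = sym (1^n≡1 (suc (toℕ j)))
      average-free (v ∷ l) j = begin
        sum {N} (λ i → h * average l (λ J → free j (insert (v , i) J)))
          ≡⟨ (sum-cong N λ i → trans
               (cong (h *_) (trans (average-cong l (free-insert j v i)) (average-*ˡ l (factor v i j) (free j))))
               (sym (*-assoc h _ _))) ⟩
        sum {N} (λ i → h * factor v i j * average l (free j))
          ≡⟨ sum-*ʳ N _ (average l (free j)) ⟩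
        sum {N} (λ i → h * factor v i j) * average l (free j)
          ≡⟨ cong₂ _*_ (average-factor v j) (average-free l j) ⟩
        survive v ^ suc (toℕ j) * D l ^ suc (toℕ j)
          ≡⟨ ^-distribʳ-* (survive v) (D l) (suc (toℕ j)) ⟨
        D (v ∷ l) ^ suc (toℕ j) ∎
        where open ≡-Reasoning

      Wx : V → ℝ
      Wx v = W v * x v

      0≤sumWx : ∀ l → 0# ≤ sumᴸ Wx l
      0≤sumWx []      = ≤-refl
      0≤sumWx (v ∷ l) = +-nonneg (*-nonneg (0≤W v) (0≤x v)) (0≤sumWx l)

      -- A general φ is needed for the induction on `l`: detaching `v` leaves the same problem for
      -- the other vertices, with φ discounted by the blocking of `v`.
      average-reward : ∀ l φ → (∀ i → 0# ≤ φ i) →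
        sum {N} (λ i → h * φ i * (sumᴸ Wx l * D l ^ suc (toℕ i))) ≤ average l (reward φ)
      average-reward [] φ 0≤φ = ≤-reflexive (sum-zero N λ i → trans (cong (h * φ i *_) (zeroˡ _)) (zeroʳ _))
      average-reward (v ∷ l) φ 0≤φ = ≤-trans (sum-mono N first) (≤-trans (≤-reflexive exchange) (sum-mono N second))
        where
        d : Fin N → ℝ
        d i = D l ^ suc (toℕ i)
        own rest : Fin N → ℝ
        own i = h * (φ i * (W v * Y v i) * d i)
        rest j = h * φ j * (sumᴸ Wx l * d j)
        -- In the term of `v` itself, i of the i + 1 factors `survive v` are its own thinning,
        -- contained in `Y v i`; the remaining one is dropped.
        first : ∀ i → h * φ i * (sumᴸ Wx (v ∷ l) * D (v ∷ l) ^ suc (toℕ i)) ≤ own i + rest i * survive v ^ suc (toℕ i)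
        first i = ≤-trans (≤-reflexive (trans
            (cong (λ z → h * φ i * (sumᴸ Wx (v ∷ l) * z)) (^-distribʳ-* (survive v) (D l) (suc (toℕ i))))
            (solve 8 (λ h f w x s S p d → h :* f :* ((w :* x :+ s) :* ((S :* p) :* d))
                   := S :* (h :* (f :* (w :* (p :* x)) :* d)) :+ h :* f :* (s :* d) :* (S :* p)) refl
               h (φ i) (W v) (x v) (sumᴸ Wx l) (survive v) (survive v ^ toℕ i) (d i))))
          (+-monoˡ-≤ _ (≤-trans (*-monoʳ-≤ 0≤own (survive≤1 v)) (≤-reflexive (*-identityˡ _))))
          where
          0≤own : 0# ≤ own i
          0≤own = *-nonneg 0≤h (*-nonneg (*-nonneg (0≤φ i) (*-nonneg (0≤W v) (0≤Y v i)))
                                         (^-nonneg (suc (toℕ i)) (0≤D l)))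
        bound : Fin N → ℝ
        bound i = φ i * (W v * Y v i) * d i
                + sum {N} (λ j → h * discounted φ v i j * (sumᴸ Wx l * d j))
        -- `average-factor` is read backwards: the power becomes an average over the slot of `v`,
        -- and swapping the sums exposes the discounted φ of the induction hypothesis.
        exchange : sum {N} (λ i → own i + rest i * survive v ^ suc (toℕ i)) ≡ sum {N} (λ i → h * bound i)
        exchange = begin
          sum {N} (λ i → own i + rest i * survive v ^ suc (toℕ i))
            ≡⟨ sum-+ N own _ ⟩
          sum own + sum {N} (λ j → rest j * survive v ^ suc (toℕ j))
            ≡⟨ cong (sum own +_) (sum-cong N λ j → trans (cong (rest j *_) (sym (average-factor v j)))
                 (sym (sum-*ˡ N (rest j) _))) ⟩
          sum own + sum {N} (λ j → sum {N} λ i → rest j * (h * factor v i j))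
            ≡⟨ cong (sum own +_) (sum-swap N N _) ⟩
          sum own + sum {N} (λ i → sum {N} λ j → rest j * (h * factor v i j))
            ≡⟨ sum-+ N own _ ⟨
          sum {N} (λ i → own i + sum {N} λ j → rest j * (h * factor v i j))
            ≡⟨ (sum-cong N λ i → trans
                 (cong (own i +_) (trans
                   (sum-cong N λ j → solve 5 (λ h f s d c → h :* f :* (s :* d) :* (h :* c)
                       := h :* (h :* (f :* c) :* (s :* d))) refl h (φ j) (sumᴸ Wx l) (d j) (factor v i j))
                   ((sum-*ˡ N h _))))
                 (sym (distribˡ h _ _))) ⟩
          sum {N} (λ i → h * bound i) ∎
          where open ≡-Reasoning
        second : ∀ i → h * bound i ≤ h * average l (λ J → reward φ (insert (v , i) J))
        second i = *-monoˡ-≤ 0≤h (≤-trans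
          (+-mono-≤ (≤-reflexive (sym (trans (average-*ˡ l _ (free i)) (cong (_ *_) (average-free l i)))))
                    (average-reward l (discounted φ v i) λ j → *-nonneg (0≤φ j) (0≤factor v i j)))
          (≤-trans (≤-reflexive (sym (average-+ l _ _)))
            (average-mono-≤ l λ J sorted _ → reward-insert φ v i 0≤φ sorted)))

      -- The Weierstrass product inequality; the discarded cross terms are nonnegative.
      1-hx≤D : ∀ l → 1# - h * sumᴸ x l ≤ D l
      1-hx≤D [] = ≤-reflexive (solve 1 (λ h → :1 :- h :* :0 := :1) refl h)
      1-hx≤D (v ∷ l) = ≤-trans
        (≤-by (*-nonneg (0≤hx v) (*-nonneg 0≤h (0≤sumx l)))
          (solve 3 (λ h x s → :1 :- h :* (x :+ s) :+ h :* x :* (h :* s) := (:1 :- h :* x) :* (:1 :- h :* s))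
             refl h (x v) _))
        (*-monoˡ-≤ (0≤survive v) (1-hx≤D l))
        where
        0≤sumx : ∀ l → 0# ≤ sumᴸ x l
        0≤sumx []      = ≤-refl
        0≤sumx (v ∷ l) = +-nonneg (0≤x v) (0≤sumx l)

      average-reward≥ : ∀ l → sumᴸ x l ≤ 1# →
        (1# - h) * (1# - (1# - h) ^ N) * sumᴸ Wx l ≤ average l (reward λ _ → 1#)
      average-reward≥ l Σx≤1 = ≤-trans
        (≤-trans (≤-reflexive (trans (cong (_* sumᴸ Wx l) (sym (geometric N h)))
                                     (sym (sum-*ʳ N _ (sumᴸ Wx l)))))
          (sum-mono N λ i → ≤-trans
            (≤-reflexive (solve 3 (λ h p s → h :* p :* s := h :* :1 :* (s :* p)) refl h _ _))
            (*-monoˡ-≤ (*-nonneg 0≤h 0≤1) (*-monoˡ-≤ (0≤sumWx l)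
              (^-monoˡ-≤ (suc (toℕ i)) (0≤1-x h≤1) 1-h≤D)))))
        (average-reward l (λ _ → 1#) λ _ → 0≤1)
        where
        1-h≤D : 1# - h ≤ D l
        1-h≤D = ≤-trans
          (≤-by (*-nonneg 0≤h (x≤y⇒0≤y-x Σx≤1))
            (solve 2 (λ h s → :1 :- h :+ h :* (:1 :- s) := :1 :- h :* s) refl h _))
          (1-hx≤D l)

-- From adaptive policies to non-adaptive algorithms.

module Rounding (R : CompleteOrderedField) (G : StochasticProbing.StochasticGraph R)
                (closed : StochasticProbing.SubstringClosed R G) where
  open OrderedField R
  open StochasticProbing R
  open StochasticGraph G hiding (|U|; |V|)
  open Probing G
  open Policies R G

  LString : Set
  LString = List (Edge × Bool)

  -- The chance that u is at the first active edge labelled true.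
  hit : Fin nᵤ → LString → ℝ
  hit u []              = 0#
  hit u ((e , true) ∷ s)  = p e * row u e + (1# - p e) * hit u s
  hit u ((e , false) ∷ s) = hit u s

  -- With β as prices, this is the expected price of the vertex u proposed to. Prices may be
  -- negative.
  gain : (Fin nᵤ → ℝ) → LString → ℝ
  gain β []              = 0#
  gain β ((e , true) ∷ s)  = p e * β (proj₁ e) + (1# - p e) * gain β s
  gain β ((e , false) ∷ s) = gain β s

  sum-hit : ∀ β s → sum (λ u → β u * hit u s) ≡ gain β s
  sum-hit β []              = sum-zero nᵤ λ u → zeroʳ (β u)
  sum-hit β ((e , false) ∷ s) = sum-hit β s
  sum-hit β ((e , true) ∷ s)  = begin
    sum (λ u → β u * (p e * row u e + (1# - p e) * hit u s))
      ≡⟨ (sum-cong nᵤ λ u → solve 4 (λ b q r h → b :* (q :* r :+ (:1 :- q) :* h) := q :* (b :* r) :+ (:1 :- q) :* (b :* h))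
            refl (β u) (p e) (row u e) (hit u s)) ⟩
    sum (λ u → p e * (β u * row u e) + (1# - p e) * (β u * hit u s))
      ≡⟨ sum-+ nᵤ (λ u → p e * (β u * row u e)) (λ u → (1# - p e) * (β u * hit u s)) ⟩
    sum (λ u → p e * (β u * row u e)) + sum (λ u → (1# - p e) * (β u * hit u s))
      ≡⟨ cong₂ _+_ (sum-*ˡ nᵤ (p e) (λ u → β u * row u e)) (sum-*ˡ nᵤ (1# - p e) (λ u → β u * hit u s)) ⟩
    p e * sum (λ u → β u * row u e) + (1# - p e) * sum (λ u → β u * hit u s)
      ≡⟨ cong₂ (λ y z → p e * y + (1# - p e) * z) (sum-row β e) (sum-hit β s) ⟩
    p e * β (proj₁ e) + (1# - p e) * gain β s ∎
    where open ≡-Reasoning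

  -- A mixture never exceeds the larger of its two parts, so one fixed outcome of the probe does at
  -- least as well.
  better-branch : ∀ {q x₁ x₀ c} (y : Bool → ℝ) → 0# ≤ q → q ≤ 1# → x₁ ≤ y true → x₀ ≤ y false →
                  c ≤ q * x₁ + (1# - q) * x₀ → ∃[ b ] c ≤ y b
  better-branch {q} y 0≤q q≤1 x₁≤ x₀≤ c≤ with total (y true) (y false)
  ... | inj₁ y₁≤y₀ = false , ≤-trans c≤ (≤-trans (mix-mono-≤ 0≤q q≤1 (≤-trans x₁≤ y₁≤y₀) x₀≤) (≤-reflexive (mix-const q _)))
  ... | inj₂ y₀≤y₁ = true  , ≤-trans c≤ (≤-trans (mix-mono-≤ 0≤q q≤1 x₁≤ (≤-trans x₀≤ y₀≤y₁)) (≤-reflexive (mix-const q _)))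

  -- Prices β on the edges at `v`, scaled by thinning factors q: the value of a policy for these
  -- weights is the sum over u of β u * q u times its probability of matching u to `v`.
  local : Fin nᵥ → (Fin nᵤ → ℝ) → (Fin nᵤ → ℝ) → Fin nᵤ → Fin nᵥ → ℝ
  local v β q u v′ = if does (v′ ≟ v) then β u * q u else 0#

  module _ (v : Fin nᵥ) (β q : Fin nᵤ → ℝ) (0≤q : ∀ u → 0# ≤ q u) (q≤1 : ∀ u → q u ≤ 1#) where

    -- The states of the edges outside v, and of the edges at v which the policy probes without
    -- accepting, are fixed one after the other so as to maximise the conditional gain.
    best-string : ∀ π → ReadOnce π → Matching π →
      Σ[ s ∈ LString ] ∃[ st ] map proj₁ s ≡ at v (probes π st) × Val (uncurry (local v β q)) π ≤ gain β s
    best-string stop once match = [] , (λ _ → true) , refl , ≤-refl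
    best-string π@(probe e a π₁ π₀) once match = result (proj₂ e ≟ v)
      where
      f : Edge → ℝ
      f = uncurry (local v β q)
      ih : ∀ b → Σ[ s ∈ LString ] ∃[ st ] map proj₁ s ≡ at v (probes (branch b π₁ π₀) st) × Val f (branch b π₁ π₀) ≤ gain β s
      ih true  = best-string π₁ (branch-readOnce {e} {a} {π₁} {π₀} once true) (branch-matching {e} {a} {π₁} {π₀} once match true)
      ih false = best-string π₀ (branch-readOnce {e} {a} {π₁} {π₀} once false) (branch-matching {e} {a} {π₁} {π₀} once match false)
      st : Bool → State
      st b = proj₁ (proj₂ (ih b)) [ e ≔ b ]
      trace : ∀ b → at v (probes π (st b)) ≡ at v (e ∷ probes (branch b π₁ π₀) (proj₁ (proj₂ (ih b))))
      trace b = cong (at v) (branch-probes {e} {a} {π₁} {π₀} once b _)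
      strings : ∀ b → map proj₁ (proj₁ (ih b)) ≡ at v (probes (branch b π₁ π₀) (proj₁ (proj₂ (ih b))))
      strings b = proj₁ (proj₂ (proj₂ (ih b)))
      gains : ∀ b → Val f (branch b π₁ π₀) ≤ gain β (proj₁ (ih b))
      gains b = proj₂ (proj₂ (proj₂ (ih b)))
      ignored : (if a then f e else 0#) ≤ 0# → ∃[ b ] Val f π ≤ gain β (proj₁ (ih b))
      ignored ≤0 = better-branch (λ b → gain β (proj₁ (ih b))) (0≤p e) (p≤1 e) (gains true) (gains false)
        (mix-mono-≤ (0≤p e) (p≤1 e) (≤-trans (+-monoˡ-≤ _ ≤0) (≤-reflexive (+-identityˡ _))) ≤-refl)
      ignore-at-v : proj₂ e ≡ v → (if a then f e else 0#) ≤ 0# →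
        Σ[ s ∈ LString ] ∃[ st ] map proj₁ s ≡ at v (probes π st) × Val f π ≤ gain β s
      ignore-at-v at-v ≤0 = let b , ≤gain = ignored ≤0 in
        (e , false) ∷ proj₁ (ih b) , st b
        , trans (cong (e ∷_) (strings b)) (sym (trans (trace b) (filter-accept (λ e → proj₂ e ≟ v) at-v)))
        , ≤gain
      result : Dec (proj₂ e ≡ v) → Σ[ s ∈ LString ] ∃[ st ] map proj₁ s ≡ at v (probes π st) × Val f π ≤ gain β s
      result (no v′≢v) = let b , ≤gain = ignored (≤-reflexive (not-at-v a)) in
        proj₁ (ih b) , st b
        , trans (strings b) (sym (trans (trace b) (filter-reject (λ e → proj₂ e ≟ v) v′≢v)))
        , ≤gain
        where
        not-at-v : ∀ a → (if a then f e else 0#) ≡ 0#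
        not-at-v true  = cong (if_then β (proj₁ e) * q (proj₁ e) else 0#) (dec-false (proj₂ e ≟ v) v′≢v)
        not-at-v false = refl
      result (yes at-v) = accept a refl
        where
        fe≡ : f e ≡ β (proj₁ e) * q (proj₁ e)
        fe≡ = cong (if_then β (proj₁ e) * q (proj₁ e) else 0#) (dec-true (proj₂ e ≟ v) at-v)
        accept : ∀ a′ → a ≡ a′ → Σ[ s ∈ LString ] ∃[ st ] map proj₁ s ≡ at v (probes π st) × Val f π ≤ gain β s
        accept false refl = ignore-at-v at-v ≤-refl
        accept true  refl with total 0# (β (proj₁ e))
        -- At a nonpositive price the accepted edge contributed nothing positive, so it is
        -- relabelled as ignored.
        ... | inj₂ β≤0 = ignore-at-v at-v (≤-trans (≤-reflexive fe≡)
              (≤-trans (*-monoʳ-≤ (0≤q _) β≤0) (≤-reflexive (zeroˡ _))))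
        -- Once `e` is accepted, `v` is matched and π₁ earns nothing there; thus the active outcome
        -- is worth β q, at most β. The string therefore continues along the inactive branch, and
        -- the factor q is removed at no loss.
        ... | inj₁ 0≤β = (e , true) ∷ proj₁ (ih false) , st false
              , trans (cong (e ∷_) (strings false)) (sym (trans (trace false) (filter-accept (λ e → proj₂ e ≟ v) at-v)))
              , mix-mono-≤ (0≤p e) (p≤1 e)
                  (≤-trans (≤-reflexive (trans (cong₂ _+_ fe≡ π₁-misses-v) (+-identityʳ _)))
                    (≤-trans (*-monoˡ-≤ 0≤β (q≤1 _)) (≤-reflexive (*-identityʳ _))))
                  (gains false)
          where
          π₁-misses-v : Val f π₁ ≡ 0#
          π₁-misses-v = Val≡0 π₁ (branch-readOnce {e} {a} {π₁} {π₀} once true) λ st →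
            All.map (λ {e′} disj → cong (if_then β (proj₁ e′) * q (proj₁ e′) else 0#)
                       (dec-false (proj₂ e′ ≟ v) λ at-v′ → proj₂ disj (trans at-v (sym at-v′))))
              (AllPairs.head (accepted-matching {e} {π₁} {π₀} once match st))

  -- val u K is the expected weight collected at u when the vertices in K propose to u one after
  -- the other, with probability y u for an entry (v , y), and u accepts the first proposal.
  val : Fin nᵤ → List (Fin nᵥ × (Fin nᵤ → ℝ)) → ℝ
  val u []            = 0#
  val u ((v , y) ∷ K) = w (u , v) * y u + (1# - y u) * val u K

  -- The non-adaptive algorithm that runs one string after the other.

  Job : Set
  Job = Fin nᵥ × LString

  proposal : Job → Fin nᵥ × (Fin nᵤ → ℝ)
  proposal (v , s) = v , λ u → hit u s

  Owned : Fin nᵥ → LString → Set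
  Owned v s = All (λ e → proj₂ e ≡ v) (map proj₁ s)

  _∖_ : (Fin nᵤ → Bool) → Fin nᵤ → Fin nᵤ → Bool
  (F ∖ u) u′ = if does (u ≟ u′) then false else F u′

  -- F tells which u are free, and d is the vertex whose string is being probed, or nothing if
  -- it has already made its proposal.
  alg : (Fin nᵤ → Bool) → Maybe (Fin nᵥ) → LString → List Job → Policy
  alg F d        []                []             = stop
  alg F d        []                ((v , s) ∷ js) = alg F (just v) s js
  alg F (just v) ((e , true) ∷ s)  js = probe e (F (proj₁ e)) (alg (F ∖ proj₁ e) nothing s js) (alg F (just v) s js)
  alg F (just v) ((e , false) ∷ s) js = probe e false (alg F (just v) s js) (alg F (just v) s js)
  alg F nothing  ((e , _) ∷ s)     js = probe e false (alg F nothing s js) (alg F nothing s js)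

  trace : List Job → List Edge
  trace []             = []
  trace ((v , s) ∷ js) = map proj₁ s ++ trace js

  -- Non-adaptivity: both outcomes of a probe go on with the same strings, since the rest of a
  -- string is still probed after its proposal.
  alg-probes : ∀ F d s js st → probes (alg F d s js) st ≡ map proj₁ s ++ trace js
  alg-probes F d [] [] st = refl
  alg-probes F d [] ((v , s) ∷ js) st = alg-probes F (just v) s js st
  alg-probes F (just v) ((e , true) ∷ s) js st with st e
  ... | true  = cong (e ∷_) (alg-probes (F ∖ proj₁ e) nothing s js st)
  ... | false = cong (e ∷_) (alg-probes F (just v) s js st)
  alg-probes F (just v) ((e , false) ∷ s) js st with st e
  ... | true  = cong (e ∷_) (alg-probes F (just v) s js st)
  ... | false = cong (e ∷_) (alg-probes F (just v) s js st)
  alg-probes F nothing ((e , _) ∷ s) js st with st e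
  ... | true  = cong (e ∷_) (alg-probes F nothing s js st)
  ... | false = cong (e ∷_) (alg-probes F nothing s js st)

  available : Maybe (Fin nᵥ) → List Job → List (Fin nᵥ)
  available (just v) js = v ∷ map proj₁ js
  available nothing  js = map proj₁ js

  OwnedBy : Maybe (Fin nᵥ) → LString → Set
  OwnedBy (just v) s = Owned v s
  OwnedBy nothing  s = ⊤

  InRange : (Fin nᵤ → Bool) → List (Fin nᵥ) → Edge → Set
  InRange F A e = F (proj₁ e) ≡ true × proj₂ e ∈ A

  ∖-⊆ : ∀ F u {u′} → (F ∖ u) u′ ≡ true → F u′ ≡ true × u ≢ u′
  ∖-⊆ F u {u′} eq with u ≟ u′
  ... | no u≢u′ = eq , u≢u′

  -- The invariant behind `alg-matching`: a proposal removes its u from `F` and its v from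
  -- `available`, so all later output is disjoint from an accepted edge.
  alg-range : ∀ F d s js → OwnedBy d s → All (uncurry Owned) js → ∀ st →
              All (InRange F (available d js)) (output (alg F d s js) st)
  alg-range F d [] [] o os st = []
  alg-range F (just v) [] ((v′ , s) ∷ js) o (o′ ∷ os) st =
    All.map (λ (f , m) → f , there m) (alg-range F (just v′) s js o′ os st)
  alg-range F nothing [] ((v′ , s) ∷ js) o (o′ ∷ os) st = alg-range F (just v′) s js o′ os st
  alg-range F (just v) ((e , true) ∷ s) js (refl ∷ o) os st with st e
  ... | false = alg-range F (just v) s js o os st
  ... | true  with F (proj₁ e) in eq
                 | All.map (λ (f , m) → proj₁ (∖-⊆ F (proj₁ e) f) , there {x = v} m)
                           (alg-range (F ∖ proj₁ e) nothing s js tt os st)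
  ...   | true  | rest = (eq , here refl) ∷ rest
  ...   | false | rest = rest
  alg-range F (just v) ((e , false) ∷ s) js (_ ∷ o) os st with st e
  ... | true  = alg-range F (just v) s js o os st
  ... | false = alg-range F (just v) s js o os st
  alg-range F nothing ((e , _) ∷ s) js o os st with st e
  ... | true  = alg-range F nothing s js tt os st
  ... | false = alg-range F nothing s js tt os st

  alg-matching : ∀ F d s js → OwnedBy d s → All (uncurry Owned) js → Unique (available d js) →
                 Matching (alg F d s js)
  alg-matching F d [] [] o os uniq st = []
  alg-matching F (just v) [] ((v′ , s) ∷ js) o (o′ ∷ os) (_ ∷ uniq) st = alg-matching F (just v′) s js o′ os uniq st
  alg-matching F nothing [] ((v′ , s) ∷ js) o (o′ ∷ os) uniq st = alg-matching F (just v′) s js o′ os uniq st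
  alg-matching F (just v) ((e , true) ∷ s) js (refl ∷ o) os uniq@(v∉ ∷ uniq′) st with st e
  ... | false = alg-matching F (just v) s js o os uniq st
  ... | true  with F (proj₁ e)
  ...   | false = alg-matching (F ∖ proj₁ e) nothing s js tt os uniq′ st
  ...   | true  = All.map (λ (f , m) → proj₂ (∖-⊆ F (proj₁ e) f) , All.lookup v∉ m)
                          (alg-range (F ∖ proj₁ e) nothing s js tt os st)
                ∷ alg-matching (F ∖ proj₁ e) nothing s js tt os uniq′ st
  alg-matching F (just v) ((e , false) ∷ s) js (_ ∷ o) os uniq st with st e
  ... | true  = alg-matching F (just v) s js o os uniq st
  ... | false = alg-matching F (just v) s js o os uniq st
  alg-matching F nothing ((e , _) ∷ s) js o os uniq st with st e
  ... | true  = alg-matching F nothing s js tt os uniq st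
  ... | false = alg-matching F nothing s js tt os uniq st

  val-now : Fin nᵤ → Maybe (Fin nᵥ) → LString → List Job → ℝ
  val-now u (just v) s js = val u (map proposal ((v , s) ∷ js))
  val-now u nothing  s js = val u (map proposal js)

  -- A vertex v spends its proposal on the first active edge labelled true, whether or not that u is
  -- free. Hence proposals do not depend on `F`, and a proposal to another vertex looks to u like no
  -- proposal.
  alg-value : ∀ u F d s js → OwnedBy d s → All (uncurry Owned) js →
    Val (λ e → row u e * w e) (alg F d s js) ≡ (if F u then val-now u d s js else 0#)
  alg-value u F (just v) [] [] o os with F u
  ... | true  = solve 1 (λ w → :0 := w :* :0 :+ (:1 :- :0) :* :0) refl (w (u , v))
  ... | false = refl
  alg-value u F nothing [] [] o os with F u
  ... | true  = refl
  ... | false = refl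
  alg-value u F (just v) [] ((v′ , s) ∷ js) o (o′ ∷ os) = trans (alg-value u F (just v′) s js o′ os)
    (cong (if F u then_else 0#) (solve 2 (λ w x → x := w :* :0 :+ (:1 :- :0) :* x) refl (w (u , v)) _))
  alg-value u F nothing [] ((v′ , s) ∷ js) o (o′ ∷ os) = alg-value u F (just v′) s js o′ os
  alg-value u F (just v) ((e@(u′ , v′) , true) ∷ s) js (refl ∷ o) os
    rewrite alg-value u (F ∖ u′) nothing s js tt os | alg-value u F (just v) s js o os with u′ ≟ u
  ... | yes refl with F u
  ...   | true  = solve 4 (λ q w h x → q :* (:1 :* w :+ :0) :+ (:1 :- q) :* (w :* h :+ (:1 :- h) :* x)
                     := w :* (q :* :1 :+ (:1 :- q) :* h) :+ (:1 :- (q :* :1 :+ (:1 :- q) :* h)) :* x)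
                    refl (p e) (w (u , v)) (hit u s) (val u (map proposal js))
  ...   | false = solve 1 (λ q → q :* (:0 :+ :0) :+ (:1 :- q) :* :0 := :0) refl (p e)
  alg-value u F (just v) ((e@(u′ , v′) , true) ∷ s) js (refl ∷ o) os | no _ with F u | accept (F u′)
    where
    accept : ∀ b → (if b then 0# * w e else 0#) ≡ 0#
    accept true  = zeroˡ _
    accept false = refl
  ...   | true  | eq rewrite eq = solve 4 (λ q w h x → q :* (:0 :+ x) :+ (:1 :- q) :* (w :* h :+ (:1 :- h) :* x)
                     := w :* (q :* :0 :+ (:1 :- q) :* h) :+ (:1 :- (q :* :0 :+ (:1 :- q) :* h)) :* x)
                    refl (p e) (w (u , v)) (hit u s) (val u (map proposal js))
  ...   | false | eq rewrite eq = solve 1 (λ q → q :* (:0 :+ :0) :+ (:1 :- q) :* :0 := :0) refl (p e)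
  alg-value u F (just v) ((e , false) ∷ s) js (_ ∷ o) os = trans
    (cong₂ (λ x y → p e * x + (1# - p e) * y)
      (trans (+-identityˡ _) (alg-value u F (just v) s js o os)) (alg-value u F (just v) s js o os))
    (mix-const (p e) _)
  alg-value u F nothing ((e , _) ∷ s) js o os = trans
    (cong₂ (λ x y → p e * x + (1# - p e) * y)
      (trans (+-identityˡ _) (alg-value u F nothing s js tt os)) (alg-value u F nothing s js tt os))
    (mix-const (p e) _)

  ValidJob : Job → Set
  ValidJob (v , s) = 𝒞 v (map proj₁ s)

  at-trace-none : ∀ v {js} → All (uncurry Owned) js → All (v ≢_) (map proj₁ js) → at v (trace js) ≡ []
  at-trace-none v [] [] = refl
  at-trace-none v {(v′ , s) ∷ js} (o ∷ os) (v≢v′ ∷ v∉) = trans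
    (filter-++ (λ e → proj₂ e ≟ v) (map proj₁ s) (trace js))
    (cong₂ _++_ (filter-none (λ e → proj₂ e ≟ v) (All.map (λ { refl refl → v≢v′ refl }) o)) (at-trace-none v os v∉))

  at-trace : ∀ v {js} → All ValidJob js → All (uncurry Owned) js → Unique (map proj₁ js) → 𝒞 v (at v (trace js))
  -- With no job left for `v` its string is empty, and closure under substrings puts `[]` into
  -- `𝒞 v`.
  at-trace v [] [] [] = closed v _ [] (here []) (proj₂ (𝒞-nonempty v))
  at-trace v {(v′ , s) ∷ js} (valid ∷ valids) (o ∷ os) (v′∉ ∷ uniq) with v′ ≟ v
  ... | yes refl = subst (𝒞 v) (sym (trans (filter-++ (λ e → proj₂ e ≟ v) (map proj₁ s) (trace js))
          (trans (cong₂ _++_ (filter-all (λ e → proj₂ e ≟ v) o) (at-trace-none v os v′∉)) (++-identityʳ _)))) valid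
  ... | no v′≢v = subst (𝒞 v) (sym (trans (filter-++ (λ e → proj₂ e ≟ v) (map proj₁ s) (trace js))
          (cong (_++ at v (trace js)) (filter-none (λ e → proj₂ e ≟ v) (All.map (λ { refl → v′≢v }) o)))))
          (at-trace v valids os uniq)

  jobs≤OPTₙₐ : ∀ js → All ValidJob js → Unique (map proj₁ js) →
               sum (λ u → val u (map proposal js)) ≤ OPTₙₐ G closed
  jobs≤OPTₙₐ js valid uniq = subst (_≤ OPTₙₐ G closed)
    (trans (deterministic-value π-valid) (trans (Val-rows π)
      (sum-cong nᵤ λ u → alg-value u (λ _ → true) nothing [] js tt owned)))
    (proj₁ (proj₂ (supremum _ _ _)) _
      (deterministic π-valid , (λ _ → trace js , alg-probes _ nothing [] js) , refl))
    where
    owned : All (uncurry Owned) js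
    owned = All.map (λ {(v , s)} → 𝒞-incident v (map proj₁ s)) valid
    π : Policy
    π = alg (λ _ → true) nothing [] js
    π-valid : Valid π
    π-valid = record
      { respects = λ st v → subst (λ σ → 𝒞 v (at v σ)) (sym (alg-probes _ nothing [] js st)) (at-trace v valid owned uniq)
      ; matching = alg-matching _ nothing [] js tt owned uniq
      }

  -- Choosing the strings, and the bound for a single policy.

  module _ {π : Policy} (π-valid : Valid π) where
    private
      once : ReadOnce π
      once = valid-readOnce π-valid

    x : Fin nᵤ → Fin nᵥ → ℝ
    x u v = Val (δ (u , v)) π

    -- The factor q depends on u as well as on v, because the thinning is tuned to x u v.
    Thinned : Fin nᵥ × (Fin nᵤ → ℝ) → Set
    Thinned (v , y) = Σ[ q ∈ (Fin nᵤ → ℝ) ] (∀ u → 0# ≤ q u) × (∀ u → q u ≤ 1#) × (∀ u → y u ≡ q u * x u v)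

    -- Strings are fixed from the front, the later vertices still being random. General coefficients
    -- `c` are needed because, once the string of `v` is fixed, what comes later at u counts only if
    -- `v` has not proposed to u.
    choose-strings : ∀ K → All Thinned K → ∀ c →
      Σ[ js ∈ List Job ] map proj₁ js ≡ map proj₁ K × All ValidJob js
        × sum (λ u → c u * val u K) ≤ sum (λ u → c u * val u (map proposal js))
    choose-strings [] [] c = [] , refl , [] , ≤-refl
    choose-strings ((v , y) ∷ K) ((q , 0≤q , q≤1 , y≡qx) ∷ thinned) c =
      let js , owners , valids , val≤ = choose-strings K thinned c′ in
      (v , s) ∷ js , cong (v ∷_) owners , valid ∷ valids , (begin
        sum (λ u → c u * val u ((v , y) ∷ K))
          ≡⟨ affine y ⟩
        sum (λ u → c u * val u K) + sum (λ u → β u * y u)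
          ≤⟨ +-monoʳ-≤ (sum λ u → c u * val u K) β-gain ⟩
        sum (λ u → c u * val u K) + sum (λ u → β u * hit u s)
          ≡⟨ affine (λ u → hit u s) ⟨
        sum (λ u → c u * (w (u , v) * hit u s + (1# - hit u s) * val u K))
          ≡⟨ unfold (λ u → val u K) ⟩
        sum (λ u → c u * (w (u , v) * hit u s)) + sum (λ u → c′ u * val u K)
          ≤⟨ +-monoʳ-≤ (sum λ u → c u * (w (u , v) * hit u s)) val≤ ⟩
        sum (λ u → c u * (w (u , v) * hit u s)) + sum (λ u → c′ u * val u (map proposal js))
          ≡⟨ unfold (λ u → val u (map proposal js)) ⟨
        sum (λ u → c u * val u (map proposal ((v , s) ∷ js))) ∎)
      where
      open ≤-Reasoning
      β c′ : Fin nᵤ → ℝ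
      -- The slope of the objective in y u: the weight of the new edge minus the expected weight
      -- that it displaces. It may be negative.
      β u = c u * (w (u , v) - val u K)
      best : Σ[ s ∈ LString ] ∃[ st ] map proj₁ s ≡ at v (probes π st) × Val (uncurry (local v β q)) π ≤ gain β s
      best = best-string v β q 0≤q q≤1 π once (Valid.matching π-valid)
      s : LString
      s = proj₁ best
      c′ u = c u * (1# - hit u s)
      valid : ValidJob (v , s)
      -- The chosen string is the complete probe sequence of π at `v` in one particular state.
      valid = subst (𝒞 v) (sym (proj₁ (proj₂ (proj₂ best)))) (Valid.respects π-valid _ v)
      affine : ∀ z → sum (λ u → c u * (w (u , v) * z u + (1# - z u) * val u K))
                   ≡ sum (λ u → c u * val u K) + sum (λ u → β u * z u)
      affine z = trans
        (sum-cong nᵤ λ u → solve 4 (λ c w z k → c :* (w :* z :+ (:1 :- z) :* k) := c :* k :+ c :* (w :- k) :* z)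
          refl (c u) (w (u , v)) (z u) (val u K))
        (sum-+ nᵤ (λ u → c u * val u K) (λ u → β u * z u))
      unfold : ∀ k → sum (λ u → c u * (w (u , v) * hit u s + (1# - hit u s) * k u))
                   ≡ sum (λ u → c u * (w (u , v) * hit u s)) + sum (λ u → c′ u * k u)
      unfold k = trans
        (sum-cong nᵤ λ u → solve 4 (λ c w h k → c :* (w :* h :+ (:1 :- h) :* k) := c :* (w :* h) :+ c :* (:1 :- h) :* k)
          refl (c u) (w (u , v)) (hit u s) (k u))
        (sum-+ nᵤ (λ u → c u * (w (u , v) * hit u s)) (λ u → c′ u * k u))
      β-gain : sum (λ u → β u * y u) ≤ sum (λ u → β u * hit u s)
      β-gain = begin
        sum (λ u → β u * y u)
          ≡⟨ (sum-cong nᵤ λ u → trans (cong (β u *_) (y≡qx u)) (trans (sym (*-assoc (β u) (q u) (x u v)))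
               (sym (trans (sum-single nᵥ v λ v′ v′≢v → trans
                   (cong (λ b → (if b then β u * q u else 0#) * x u v′) (dec-false (v′ ≟ v) v′≢v)) (zeroˡ (x u v′)))
                 (cong (λ b → (if b then β u * q u else 0#) * x u v) (dec-true (v ≟ v) refl)))))) ⟩
        sum (λ u → sum (λ v′ → local v β q u v′ * x u v′))
          ≡⟨ Val-expand (local v β q) π ⟨
        Val (uncurry (local v β q)) π
          ≤⟨ proj₂ (proj₂ (proj₂ best)) ⟩
        gain β s
          ≡⟨ sum-hit β s ⟨
        sum (λ u → β u * hit u s) ∎

    x-nonneg : ∀ u v → 0# ≤ x u v
    x-nonneg u v = Val-nonneg π λ e → δ-nonneg (does ((u , v) ≟ᴱ e))
      where
      δ-nonneg : ∀ b → 0# ≤ (if b then 1# else 0#)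
      δ-nonneg true  = 0≤1
      δ-nonneg false = ≤-refl

    sum-x≤1 : ∀ u → sum (λ v → x u v) ≤ 1#
    sum-x≤1 u = subst (_≤ 1#)
      (trans (Val-expand (λ u′ v → row u (u′ , v)) π) (trans
        (sum-single nᵤ u λ u′ u′≢u → sum-zero nᵥ λ v →
          trans (cong (λ b → (if b then 1# else 0#) * x u′ v) (dec-false (u′ ≟ u) u′≢u)) (zeroˡ (x u′ v)))
        (sum-cong nᵥ λ v →
          trans (cong (λ b → (if b then 1# else 0#) * x u v) (dec-true (u ≟ u) refl)) (*-identityˡ (x u v)))))
      (Val-row≤1 u π once (Valid.matching π-valid))

    x≤1 : ∀ u v → x u v ≤ 1#
    x≤1 u v = ≤-trans (term≤sum nᵥ (x-nonneg u) v) (sum-x≤1 u)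

    module _ (n : ℕ) where
      open Exponential R using (1/1+_; 0≤1/1+; 1/1+n≤1; [1+n]*1/1+n≡1)
      private
        N : ℕ
        N = suc n
        h : ℝ
        h = 1/1+ n
      open RandomSchedule R
      open Slots (Fin nᵥ) N h (0≤1/1+ n) (trans (sum-const N h) ([1+n]*1/1+n≡1 n))
      module Row (u : Fin nᵤ) = Contention (λ v → w (u , v)) (x u) (λ v → 0≤w (u , v)) (x-nonneg u) (x≤1 u) (1/1+n≤1 n)

      reward : Fin nᵤ → Schedule → ℝ
      reward u = Row.reward u (λ _ → 1#)

      thin : Fin nᵥ × Fin N → Fin nᵥ × (Fin nᵤ → ℝ)
      thin (v , i) = v , λ u → Row.Y u v i

      thinned : ∀ J → All Thinned (map thin J)
      thinned []            = []
      thinned ((v , i) ∷ J) = ((λ u → Row.survive u v ^ toℕ i)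
        , (λ u → ^-nonneg (toℕ i) (Row.0≤survive u v))
        , (λ u → ^≤1 (toℕ i) (Row.0≤survive u v) (Row.survive≤1 u v))
        , λ u → refl) ∷ thinned J

      reward≡val : ∀ u J → reward u J ≡ val u (map thin J)
      reward≡val u []            = refl
      reward≡val u ((v , i) ∷ J) = cong₂ _+_ (*-identityˡ _) (cong ((1# - Row.Y u v i) *_) (reward≡val u J))

      owners : ∀ J → map proj₁ (map thin J) ≡ map proj₁ J
      owners []      = refl
      owners (_ ∷ J) = cong (_ ∷_) (owners J)

      schedule≤OPTₙₐ : ∀ J → map proj₁ J ↭ allFin nᵥ → sum (λ u → reward u J) ≤ OPTₙₐ G closed
      schedule≤OPTₙₐ J J↭ =
        let js , owners≡ , valid , val≤ = choose-strings (map thin J) (thinned J) (λ _ → 1#) in begin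
        sum (λ u → reward u J)                      ≡⟨ (sum-cong nᵤ λ u → trans (reward≡val u J) (sym (*-identityˡ _))) ⟩
        sum (λ u → 1# * val u (map thin J))         ≤⟨ val≤ ⟩
        sum (λ u → 1# * val u (map proposal js))    ≡⟨ (sum-cong nᵤ λ u → *-identityˡ _) ⟩
        sum (λ u → val u (map proposal js))         ≤⟨ jobs≤OPTₙₐ js valid (subst Unique (sym (trans owners≡ (owners J)))
                                                          (Unique-resp-↭ (setoid _) (↭⇒↭ₛ (↭-sym J↭)) (allFin⁺ nᵥ))) ⟩
        OPTₙₐ G closed                              ∎
        where open ≤-Reasoning

      -- All u share the same random slots, so the sum over u moves inside the average, where every
      -- single schedule is bounded by `OPTₙₐ`.
      discrete-bound : (1# - h) * (1# - (1# - h) ^ N) * Val w π ≤ OPTₙₐ G closed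
      discrete-bound = begin
        c * Val w π
          ≡⟨ cong (c *_) (Val-expand (λ u v → w (u , v)) π) ⟩
        c * sum (λ u → sum λ v → w (u , v) * x u v)
          ≡⟨ sum-*ˡ nᵤ c (λ u → sum λ v → w (u , v) * x u v) ⟨
        sum (λ u → c * sum λ v → w (u , v) * x u v)
          ≡⟨ (sum-cong nᵤ λ u → cong (c *_) (sym (sumᴸ-tabulate (Row.Wx u) id))) ⟩
        sum (λ u → c * sumᴸ (Row.Wx u) (allFin nᵥ))
          ≤⟨ (sum-mono nᵤ λ u → Row.average-reward≥ u (allFin nᵥ)
               (subst (_≤ 1#) (sym (sumᴸ-tabulate (x u) id)) (sum-x≤1 u))) ⟩
        sum (λ u → average (allFin nᵥ) (reward u))
          ≡⟨ average-sum (allFin nᵥ) reward ⟨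
        average (allFin nᵥ) (λ J → sum λ u → reward u J)
          ≤⟨ average-mono-≤ (allFin nᵥ) (λ J _ → schedule≤OPTₙₐ J) ⟩
        average (allFin nᵥ) (λ _ → OPTₙₐ G closed)
          ≡⟨ average-const (allFin nᵥ) _ ⟩
        OPTₙₐ G closed ∎
        where
        open ≤-Reasoning
        c : ℝ
        c = (1# - h) * (1# - (1# - h) ^ N)

    open Exponential R

    -- With N slots and h = 1/N, the bound reads (1 - h) k ≤ o. Multiplied by N it gives (k - o) N ≤
    -- N h k = k, uniformly in N.
    policy≤OPTₙₐ : (1# - 1# / e) * Val w π ≤ OPTₙₐ G closed
    policy≤OPTₙₐ = archimedean λ
      { zero    → subst (_≤ k) (sym (zeroʳ _)) 0≤k
      ; (suc n) → let h = 1/1+ n in ≤-trans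
          (≤-by (*-nonneg (0≤fromℕ (suc n)) (x≤y⇒0≤y-x (≤-trans (*-monoˡ-≤ (0≤1-x (1/1+n≤1 n)) (slot-bound n))
                (≤-trans (≤-reflexive (sym (*-assoc (1# - h) _ _))) (discrete-bound n)))))
            (solve 4 (λ k o N h → (k :- o) :* N :+ N :* (o :- (:1 :- h) :* k) := N :* h :* k) refl
              k (OPTₙₐ G closed) (fromℕ (suc n)) h))
          (≤-reflexive (trans (cong (_* k) ([1+n]*1/1+n≡1 n)) (*-identityˡ k))) }
      where
      k : ℝ
      k = (1# - 1# / e) * Val w π
      0≤V : 0# ≤ Val w π
      0≤V = Val-nonneg π 0≤w
      0≤k : 0# ≤ k
      0≤k = *-nonneg (0≤1-x 1/e≤1) 0≤V
      slot-bound : ∀ n → k ≤ (1# - (1# - 1/1+ n) ^ suc n) * Val w π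
      slot-bound n = *-monoʳ-≤ 0≤V (≤-by (x≤y⇒0≤y-x ([1-1/n]^n≤1/e n))
        (solve 2 (λ a b → :1 :- a :+ (a :- b) := :1 :- b) refl (1# / e) ((1# - 1/1+ n) ^ suc n)))

  open Exponential R

  [1-1/e]*OPT≤OPTₙₐ : (1# - 1# / e) * OPT G closed ≤ OPTₙₐ G closed
  [1-1/e]*OPT≤OPTₙₐ = *-sup-≤ (proj₂ (supremum _ _ _)) (_ , idle closed , refl) (0≤1-x 1/e≤1)
    λ { _ (A , refl) → algorithm≤ A }
    where
    k o : ℝ
    k = 1# - 1# / e
    o = OPTₙₐ G closed
    algorithm≤ : ∀ A → k * Algorithm.value A ≤ o
    algorithm≤ A = begin
      k * sum (λ i → prob i * expectedWeight (policy i))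
        ≡⟨ sum-*ˡ seeds k (λ i → prob i * expectedWeight (policy i)) ⟨
      sum (λ i → k * (prob i * expectedWeight (policy i)))
        ≡⟨ (sum-cong seeds λ i → trans
             (cong (λ z → k * (prob i * z)) (expectedWeight≡Val (valid i)))
             (solve 3 (λ k p x → k :* (p :* x) := p :* (k :* x)) refl k (prob i) _)) ⟩
      sum (λ i → prob i * (k * Val w (policy i)))
        ≤⟨ (sum-mono seeds λ i → *-monoˡ-≤ (0≤prob i) (policy≤OPTₙₐ (valid i))) ⟩
      sum (λ i → prob i * o)
        ≡⟨ sum-*ʳ seeds prob o ⟩
      sum prob * o
        ≡⟨ trans (cong (_* o) ∑prob) (*-identityˡ o) ⟩
      o ∎
      where
      open Algorithm A
      open ≤-Reasoning

-- Complete bipartite graphs with one probe per v.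

module UnitPatience (R : CompleteOrderedField) (m n : ℕ) (a : CompleteOrderedField.ℝ R)
  (0≤a : CompleteOrderedField._≤_ R (CompleteOrderedField.0# R) a)
  (a≤1 : CompleteOrderedField._≤_ R a (CompleteOrderedField.1# R)) where
  open OrderedField R
  open StochasticProbing R

  graph : StochasticGraph
  graph = record
    { |U| = m ; |V| = n
    ; w = λ _ → 1# ; p = λ _ → a
    ; 0≤w = λ _ → 0≤1 ; 0≤p = λ _ → 0≤a ; p≤1 = λ _ → a≤1
    ; 𝒞 = λ v s → s ≡ [] ⊎ ∃[ u ] s ≡ (u , v) ∷ []
    ; 𝒞-nonempty = λ v → [] , inj₁ refl
    ; 𝒞-incident = λ { v s (inj₁ refl) → [] ; v s (inj₂ (u , refl)) → refl ∷ [] }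
    ; 𝒞-distinct = λ { v s (inj₁ refl) → [] ; v s (inj₂ (u , refl)) → [] ∷ [] }
    }

  open StochasticGraph graph using (Edge; 𝒞; w)
  open Probing graph
  open Policies R graph

  closed : SubstringClosed graph
  closed v _ _ (here [])           (inj₁ refl)       = inj₁ refl
  closed v _ _ (here [])           (inj₂ (u , refl)) = inj₁ refl
  closed v _ _ (here (refl ∷ []))  (inj₂ (u , refl)) = inj₂ (u , refl)
  closed v _ _ (there (here []))   (inj₂ (u , refl)) = inj₁ refl

  greedy : List (Fin m) → List (Fin n) → Policy
  greedy []       vs       = stop
  greedy (u ∷ us) []       = stop
  greedy (u ∷ us) (v ∷ vs) = probe (u , v) true (greedy us vs) (greedy (u ∷ us) vs)

  greedy-range : ∀ us vs st → All (λ e → proj₂ e ∈ vs) (probes (greedy us vs) st)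
  greedy-range []       vs       st = []
  greedy-range (u ∷ us) []       st = []
  greedy-range (u ∷ us) (v ∷ vs) st with st (u , v)
  ... | true  = here refl ∷ All.map there (greedy-range us vs st)
  ... | false = here refl ∷ All.map there (greedy-range (u ∷ us) vs st)

  greedy-output : ∀ us vs st → All (λ e → proj₁ e ∈ us × proj₂ e ∈ vs) (output (greedy us vs) st)
  greedy-output []       vs       st = []
  greedy-output (u ∷ us) []       st = []
  greedy-output (u ∷ us) (v ∷ vs) st with st (u , v)
  ... | true  = (here refl , here refl) ∷ All.map (λ (u∈ , v∈) → there u∈ , there v∈) (greedy-output us vs st)
  ... | false = All.map (λ (u∈ , v∈) → u∈ , there v∈) (greedy-output (u ∷ us) vs st)

  at-greedy : ∀ us vs → Unique vs → ∀ v st → 𝒞 v (at v (probes (greedy us vs) st))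
  at-greedy []       vs        uniq       v st = inj₁ refl
  at-greedy (u ∷ us) []        uniq       v st = inj₁ refl
  at-greedy (u ∷ us) (v′ ∷ vs) (v′∉ ∷ uniq) v st = split (v′ ≟ v)
    where
    rest : List Edge
    rest = if st (u , v′) then probes (greedy us vs) st else probes (greedy (u ∷ us) vs) st
    rest-range : All (λ e → proj₂ e ∈ vs) rest
    rest-range with st (u , v′)
    ... | true  = greedy-range us vs st
    ... | false = greedy-range (u ∷ us) vs st
    rest-valid : 𝒞 v (at v rest)
    rest-valid with st (u , v′)
    ... | true  = at-greedy us vs uniq v st
    ... | false = at-greedy (u ∷ us) vs uniq v st
    split : Dec (v′ ≡ v) → 𝒞 v (at v ((u , v′) ∷ rest))
    split (yes refl) = inj₂ (u , trans (filter-accept (λ e → proj₂ e ≟ v) refl)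
      (cong ((u , v) ∷_) (filter-none (λ e → proj₂ e ≟ v)
        (All.map (λ v″∈ → λ { refl → All.lookup v′∉ v″∈ refl }) rest-range))))
    split (no v′≢v) = subst (𝒞 v) (sym (filter-reject (λ e → proj₂ e ≟ v) v′≢v)) rest-valid

  greedy-matching : ∀ us vs → Unique us → Unique vs → Matching (greedy us vs)
  greedy-matching []       vs       uniqᵤ uniqᵥ st = []
  greedy-matching (u ∷ us) []       uniqᵤ uniqᵥ st = []
  greedy-matching (u ∷ us) (v ∷ vs) (u∉ ∷ uniqᵤ) (v∉ ∷ uniqᵥ) st with st (u , v)
  ... | true  = All.map (λ (u∈ , v∈) → All.lookup u∉ u∈ , All.lookup v∉ v∈) (greedy-output us vs st)
              ∷ greedy-matching us vs uniqᵤ uniqᵥ st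
  ... | false = greedy-matching (u ∷ us) vs (u∉ ∷ uniqᵤ) uniqᵥ st

  greedy-valid : Valid (greedy (allFin m) (allFin n))
  greedy-valid = record
    { respects = λ st v → at-greedy (allFin m) (allFin n) (allFin⁺ n) v st
    ; matching = greedy-matching (allFin m) (allFin n) (allFin⁺ m) (allFin⁺ n)
    }

  -- With X the number of successes among N trials, greedy matches min(j, X) vertices, and
  -- 2t min(j, X) ≥ 2tj - (j - X)² - t².  The right-hand side below is the expectation of this bound.
  greedy-value : ∀ t us vs → let j = fromℕ (length us) ; N = fromℕ (length vs) in
    (t + t) * j - (j - a * N) * (j - a * N) - N * (a * (1# - a)) - t * t ≤ (t + t) * Val w (greedy us vs)
  greedy-value t [] vs = ≤-by
    (+-nonneg (+-nonneg (x*x-nonneg (a * fromℕ (length vs))) (*-nonneg (0≤fromℕ (length vs)) (*-nonneg 0≤a (0≤1-x a≤1)))) (x*x-nonneg t))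
    (solve 3 (λ t a N → (t :+ t) :* :0 :- (:0 :- a :* N) :* (:0 :- a :* N) :- N :* (a :* (:1 :- a)) :- t :* t
         :+ (a :* N :* (a :* N) :+ N :* (a :* (:1 :- a)) :+ t :* t) := (t :+ t) :* :0) refl t a (fromℕ (length vs)))
  greedy-value t (u ∷ us) [] = ≤-by (x*x-nonneg (fromℕ (length (u ∷ us)) - t))
    (solve 3 (λ t a J → (t :+ t) :* J :- (J :- a :* :0) :* (J :- a :* :0) :- :0 :* (a :* (:1 :- a)) :- t :* t
         :+ (J :- t) :* (J :- t) := (t :+ t) :* :0) refl t a (fromℕ (length (u ∷ us))))
  greedy-value t (u ∷ us) (v ∷ vs) = ≤-trans
    -- A success lowers both j and X by one and leaves j - X unchanged, so the bound satisfies the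
    -- recursion of `greedy` with equality; inequalities come only from the base cases.
    (≤-reflexive (solve 4 (λ t a J N →
       (t :+ t) :* (:1 :+ J) :- (:1 :+ J :- a :* (:1 :+ N)) :* (:1 :+ J :- a :* (:1 :+ N))
         :- (:1 :+ N) :* (a :* (:1 :- a)) :- t :* t
       := a :* ((t :+ t) :+ ((t :+ t) :* J :- (J :- a :* N) :* (J :- a :* N) :- N :* (a :* (:1 :- a)) :- t :* t))
         :+ (:1 :- a) :* ((t :+ t) :* (:1 :+ J) :- (:1 :+ J :- a :* N) :* (:1 :+ J :- a :* N)
                            :- N :* (a :* (:1 :- a)) :- t :* t)) refl t a (fromℕ (length us)) (fromℕ (length vs))))
    (≤-trans (mix-mono-≤ 0≤a a≤1 (+-monoʳ-≤ (t + t) (greedy-value t us vs)) (greedy-value t (u ∷ us) vs))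
      (≤-reflexive (solve 4 (λ t a x y → a :* (t :+ t :+ (t :+ t) :* x) :+ (:1 :- a) :* ((t :+ t) :* y)
         := (t :+ t) :* (a :* (:1 :+ x) :+ (:1 :- a) :* y)) refl t a _ _)))

  greedy≤OPT : Val w (greedy (allFin m) (allFin n)) ≤ OPT graph closed
  greedy≤OPT = subst (_≤ OPT graph closed) (deterministic-value greedy-valid)
    (proj₁ (proj₂ (supremum _ _ _)) _ (deterministic greedy-valid , refl))

  -- Upper bound for non-adaptive policies on these graphs.

  b : ℝ
  b = 1# - a

  0≤b : 0# ≤ b
  0≤b = 0≤1-x a≤1

  count : Fin m → List Edge → ℕ
  count u []      = 0
  count u (e ∷ σ) = if does (proj₁ e ≟ u) then suc (count u σ) else count u σ

  -- To match u, one of its `count u σ` independent probes has to succeed, and u is matched at most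
  -- once. Both branches of every probe follow the same remaining σ, which makes the induction work.
  row-bound : ∀ u π σ → ReadOnce π → Matching π → (∀ st → probes π st ≡ σ) → Val (row u) π ≤ 1# - b ^ count u σ
  row-bound u stop σ once match probes≡σ = subst (λ σ → 0# ≤ 1# - b ^ count u σ) (probes≡σ λ _ → true)
    (≤-reflexive (sym (-‿inverseʳ 1#)))
  row-bound u (probe e acc π₁ π₀) [] once match probes≡σ with () ← probes≡σ (λ _ → true)
  row-bound u (probe e acc π₁ π₀) (e′ ∷ σ) once match probes≡σ =
    subst (λ e′ → Val (row u) (probe e acc π₁ π₀) ≤ 1# - b ^ count u (e′ ∷ σ))
      (proj₁ (∷-injective (probes≡σ λ _ → true))) (bound (proj₁ e ≟ u))
    where
    branch-once : ∀ c → ReadOnce (branch c π₁ π₀)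
    branch-once = branch-readOnce {e} {acc} {π₁} {π₀} once
    branch-match : ∀ c → Matching (branch c π₁ π₀)
    branch-match = branch-matching {e} {acc} {π₁} {π₀} once match
    branch-probes≡ : ∀ c st → probes (branch c π₁ π₀) st ≡ σ
    branch-probes≡ c st = proj₂ (∷-injective (trans
      (sym (branch-probes {e} {acc} {π₁} {π₀} once c st)) (probes≡σ (st [ e ≔ c ]))))
    ih₁ : Val (row u) π₁ ≤ 1# - b ^ count u σ
    ih₁ = row-bound u π₁ σ (branch-once true) (branch-match true) (branch-probes≡ true)
    ih₀ : Val (row u) π₀ ≤ 1# - b ^ count u σ
    ih₀ = row-bound u π₀ σ (branch-once false) (branch-match false) (branch-probes≡ false)
    bound : Dec (proj₁ e ≡ u) → Val (row u) (probe e acc π₁ π₀) ≤ 1# - b ^ count u (e ∷ σ)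
    bound (no ≢u) = subst₂ (λ r c → a * ((if acc then (if r then 1# else 0#) else 0#) + Val (row u) π₁) + b * Val (row u) π₀
                                   ≤ 1# - b ^ (if c then suc (count u σ) else count u σ))
      (sym (dec-false (proj₁ e ≟ u) ≢u)) (sym (dec-false (proj₁ e ≟ u) ≢u))
      (≤-trans (mix-mono-≤ 0≤a a≤1 (≤-trans (≤-reflexive (nothing-gained acc)) ih₁) ih₀) (≤-reflexive (mix-const a _)))
      where
      nothing-gained : ∀ acc → (if acc then 0# else 0#) + Val (row u) π₁ ≡ Val (row u) π₁
      nothing-gained true  = +-identityˡ _
      nothing-gained false = +-identityˡ _
    bound (yes ≡u) = subst₂ (λ r c → a * ((if acc then (if r then 1# else 0#) else 0#) + Val (row u) π₁) + b * Val (row u) π₀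
                                   ≤ 1# - b ^ (if c then suc (count u σ) else count u σ))
      (sym (dec-true (proj₁ e ≟ u) ≡u)) (sym (dec-true (proj₁ e ≟ u) ≡u))
      (≤-trans (mix-mono-≤ 0≤a a≤1 (at-most-one acc refl) ih₀)
        (≤-reflexive (solve 2 (λ a x → a :* :1 :+ (:1 :- a) :* (:1 :- x) := :1 :- (:1 :- a) :* x) refl a _)))
      where
      at-most-one : ∀ acc′ → acc ≡ acc′ → (if acc′ then 1# else 0#) + Val (row u) π₁ ≤ 1#
      at-most-one false refl = ≤-trans (≤-reflexive (+-identityˡ _)) (Val-row≤1 u π₁ (branch-once true) (branch-match true))
      -- Once `e` is accepted, the matching condition excludes any further edge at `u`.
      at-most-one true  refl = ≤-reflexive (trans (cong (1# +_) (Val≡0 π₁ (branch-once true) λ st →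
          All.map (λ {e″} disj → cong (if_then 1# else 0#) (dec-false (proj₁ e″ ≟ u) λ at-u → proj₁ disj (trans ≡u (sym at-u))))
            (AllPairs.head (accepted-matching {e} {π₁} {π₀} once match st))))
        (+-identityʳ 1#))

  ^-bernoulli : ∀ k → 1# - fromℕ k * a ≤ b ^ k
  ^-bernoulli zero    = ≤-reflexive (solve 1 (λ a → :1 :- :0 :* a := :1) refl a)
  ^-bernoulli (suc k) = ≤-trans
    (≤-by (*-nonneg (0≤fromℕ k) (x*x-nonneg a))
      (solve 2 (λ k a → :1 :- (:1 :+ k) :* a :+ k :* (a :* a) := (:1 :- a) :* (:1 :- k :* a)) refl (fromℕ k) a))
    (*-monoˡ-≤ 0≤b (^-bernoulli k))

  ^-bernoulli⁻¹ : ∀ k → b ^ k * (1# + fromℕ k * a) ≤ 1#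
  ^-bernoulli⁻¹ zero    = ≤-reflexive (solve 1 (λ a → :1 :* (:1 :+ :0 :* a) := :1) refl a)
  ^-bernoulli⁻¹ (suc k) = ≤-trans
    (≤-by (*-nonneg (^-nonneg k 0≤b) (*-nonneg (+-nonneg 0≤1 (0≤fromℕ k)) (x*x-nonneg a)))
      (solve 3 (λ k a x → (:1 :- a) :* x :* (:1 :+ (:1 :+ k) :* a) :+ x :* ((:1 :+ k) :* (a :* a))
         := x :* (:1 :+ k :* a)) refl (fromℕ k) a (b ^ k)))
    (^-bernoulli⁻¹ k)

  -- The left side is the line through the points k and k + 1 of the convex sequence b ^ j.
  -- Cancelling common factors `b` reduces to j = 0 or k = 0, the two Bernoulli inequalities.
  ^-tangent : ∀ j k → b ^ k - a * b ^ k * (fromℕ j - fromℕ k) ≤ b ^ j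
  ^-tangent zero k = ≤-trans
    (≤-reflexive (solve 3 (λ a x k → x :- a :* x :* (:0 :- k) := x :* (:1 :+ k :* a)) refl a (b ^ k) (fromℕ k)))
    (^-bernoulli⁻¹ k)
  ^-tangent (suc j) zero = ≤-trans
    (≤-reflexive (solve 2 (λ a j → :1 :- a :* :1 :* (j :- :0) := :1 :- j :* a) refl a (fromℕ (suc j))))
    (^-bernoulli (suc j))
  ^-tangent (suc j) (suc k) = ≤-trans
    (≤-reflexive (solve 5 (λ a b x j k → b :* x :- a :* (b :* x) :* (:1 :+ j :- (:1 :+ k)) := b :* (x :- a :* x :* (j :- k)))
      refl a b (b ^ k) (fromℕ j) (fromℕ k)))
    (*-monoˡ-≤ 0≤b (^-tangent j k))

  sum-count : ∀ σ → sum (λ u → fromℕ (count u σ)) ≡ fromℕ (length σ)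
  sum-count []      = sum-zero m λ u → refl
  sum-count (e ∷ σ) = trans
    (trans (sum-cong m λ u → split u (does (proj₁ e ≟ u))) (sum-+ m (λ u → 1# * row u e) (λ u → fromℕ (count u σ))))
    (cong₂ _+_ (sum-row (λ _ → 1#) e) (sum-count σ))
    where
    split : ∀ u d → fromℕ (if d then suc (count u σ) else count u σ) ≡ 1# * (if d then 1# else 0#) + fromℕ (count u σ)
    split u true  = cong (_+ fromℕ (count u σ)) (sym (*-identityˡ 1#))
    split u false = sym (trans (cong (_+ fromℕ (count u σ)) (*-identityˡ 0#)) (+-identityˡ _))

  sum-at : ∀ σ → sum (λ v → fromℕ (length (at v σ))) ≡ fromℕ (length σ)
  sum-at []              = sum-zero n λ v → refl
  sum-at (e@(_ , v) ∷ σ) = trans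
    (trans (sum-cong n λ v′ → split v′ (v ≟ v′)) (sum-+ n (λ v′ → here? v′) (λ v′ → fromℕ (length (at v′ σ)))))
    (cong₂ _+_ (trans (sum-single n v λ v′ v′≢v → cong (if_then 1# else 0#) (dec-false (v ≟ v′) (v′≢v ∘ sym)))
                      (cong (if_then 1# else 0#) (dec-true (v ≟ v) refl))) (sum-at σ))
    where
    here? : Fin n → ℝ
    here? v′ = if does (v ≟ v′) then 1# else 0#
    split : ∀ v′ → Dec (v ≡ v′) → fromℕ (length (at v′ (e ∷ σ))) ≡ here? v′ + fromℕ (length (at v′ σ))
    split v′ (yes refl) = trans (cong (fromℕ ∘ length) (filter-accept (λ e → proj₂ e ≟ v′) {e} {σ} refl))
      (cong (λ d → (if d then 1# else 0#) + fromℕ (length (at v′ σ))) (sym (dec-true (v ≟ v′) refl)))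
    split v′ (no v≢v′) = trans (cong (fromℕ ∘ length) (filter-reject (λ e → proj₂ e ≟ v′) {e} {σ} v≢v′))
      (sym (trans (cong (λ d → (if d then 1# else 0#) + fromℕ (length (at v′ σ))) (dec-false (v ≟ v′) v≢v′)) (+-identityˡ _)))

  valid-length : ∀ σ → (∀ v → 𝒞 v (at v σ)) → fromℕ (length σ) ≤ fromℕ n
  valid-length σ valid = subst₂ _≤_ (sum-at σ) (trans (sum-const n 1#) (*-identityʳ _))
    (sum-mono n λ v → short (valid v))
    where
    short : ∀ {v s} → 𝒞 v s → fromℕ (length s) ≤ 1#
    short (inj₁ refl)       = 0≤1
    short (inj₂ (u , refl)) = ≤-reflexive (+-identityʳ 1#)

  module _ (k : ℕ) (n≤mk : fromℕ n ≤ fromℕ m * fromℕ k) where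

    -- Jensen's inequality in tangent form: one line at k bounds the concave 1 - b ^ j for every u,
    -- and the sum then involves only the total number of probes, at most `n` and so at most m k.
    nonadaptive-policy : ∀ {π} → Valid π → ∀ σ → (∀ st → probes π st ≡ σ) → Val w π ≤ fromℕ m * (1# - b ^ k)
    nonadaptive-policy {π} valid σ probes≡σ = begin
      Val w π
        ≡⟨ Val-rows π ⟩
      sum (λ u → Val (λ e → row u e * w e) π)
        ≡⟨ (sum-cong m λ u → Val-cong π λ e → *-identityʳ _) ⟩
      sum (λ u → Val (row u) π)
        ≤⟨ (sum-mono m λ u → ≤-trans (row-bound u π σ (valid-readOnce valid) (Valid.matching valid) probes≡σ) (line u)) ⟩
      sum (λ u → c + d * fromℕ (count u σ))
        ≡⟨ trans (sum-+ m (λ u → c) (λ u → d * fromℕ (count u σ)))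
             (cong₂ _+_ (sum-const m c) (trans (sum-*ˡ m d (λ u → fromℕ (count u σ))) (cong (d *_) (sum-count σ)))) ⟩
      fromℕ m * c + d * fromℕ (length σ)
        ≤⟨ +-monoʳ-≤ (fromℕ m * c) (*-monoˡ-≤ (*-nonneg 0≤a (^-nonneg k 0≤b)) (≤-trans (valid-length σ σ-valid) n≤mk)) ⟩
      fromℕ m * c + d * (fromℕ m * fromℕ k)
        ≡⟨ solve 4 (λ m k d x → m :* (:1 :- x :- d :* k) :+ d :* (m :* k) := m :* (:1 :- x)) refl (fromℕ m) (fromℕ k) d (b ^ k) ⟩
      fromℕ m * (1# - b ^ k) ∎
      where
      open ≤-Reasoning
      c d : ℝ
      d = a * b ^ k
      c = 1# - b ^ k - d * fromℕ k
      line : ∀ u → 1# - b ^ count u σ ≤ c + d * fromℕ (count u σ)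
      line u = ≤-by (x≤y⇒0≤y-x (^-tangent (count u σ) k))
        (solve 5 (λ x y d j k → :1 :- y :+ (y :- (x :- d :* (j :- k))) := :1 :- x :- d :* k :+ d :* j) refl
          (b ^ k) (b ^ count u σ) d (fromℕ (count u σ)) (fromℕ k))
      σ-valid : ∀ v → 𝒞 v (at v σ)
      σ-valid v = subst (λ σ → 𝒞 v (at v σ)) (probes≡σ λ _ → true) (Valid.respects valid (λ _ → true) v)

    OPTₙₐ≤ : OPTₙₐ graph closed ≤ fromℕ m * (1# - b ^ k)
    OPTₙₐ≤ = proj₂ (proj₂ (supremum _ _ _)) _ λ { _ (A , nonadaptive , refl) → bound A nonadaptive }
      where
      c : ℝ
      c = fromℕ m * (1# - b ^ k)
      bound : ∀ A → NonAdaptive A → Algorithm.value A ≤ c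
      bound A nonadaptive = begin
        sum (λ i → prob i * expectedWeight (policy i))
          ≡⟨ (sum-cong seeds λ i → cong (prob i *_) (expectedWeight≡Val (valid i))) ⟩
        sum (λ i → prob i * Val w (policy i))
          ≤⟨ (sum-mono seeds λ i → *-monoˡ-≤ (0≤prob i)
               (nonadaptive-policy (valid i) (proj₁ (nonadaptive i)) (proj₂ (nonadaptive i)))) ⟩
        sum (λ i → prob i * c)
          ≡⟨ sum-*ʳ seeds prob c ⟩
        sum prob * c
          ≡⟨ trans (cong (_* c) ∑prob) (*-identityˡ c) ⟩
        c ∎
        where
        open Algorithm A
        open ≤-Reasoning

-- The extremal graphs and their limiting ratio.

module Tightness (R : CompleteOrderedField) where
  open OrderedField R
  open Exponential R
  open StochasticProbing R

  fromℕ-+ : ∀ m n → fromℕ (m ℕ.+ n) ≡ fromℕ m + fromℕ n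
  fromℕ-+ zero    n = sym (+-identityˡ _)
  fromℕ-+ (suc m) n = trans (cong (1# +_) (fromℕ-+ m n)) (sym (+-assoc 1# _ _))

  fromℕ-* : ∀ m n → fromℕ (m ℕ.* n) ≡ fromℕ m * fromℕ n
  fromℕ-* zero    n = sym (zeroˡ _)
  fromℕ-* (suc m) n = trans (fromℕ-+ n (m ℕ.* n)) (trans (cong (fromℕ n +_) (fromℕ-* m n))
    (solve 2 (λ m n → n :+ m :* n := (:1 :+ m) :* n) refl (fromℕ m) (fromℕ n)))

  *-cancelˡ-≤ : ∀ {k x y} → 0# ≤ k → k ≢ 0# → k * x ≤ k * y → x ≤ y
  *-cancelˡ-≤ {k} 0≤k k≢0 kx≤ky = subst₂ _≤_ (cancel _) (cancel _) (*-monoˡ-≤ (0≤⁻¹ 0≤k k≢0) kx≤ky)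
    where
    cancel : ∀ x → k ⁻¹ * (k * x) ≡ x
    cancel x = trans (sym (*-assoc _ k x)) (trans (cong (_* x) (⁻¹-inverseˡ k k≢0)) (*-identityˡ x))

  module Instance (n : ℕ) where
    s m : ℕ
    -- At least 2, so that S² - S is at least 1 and `OPT` is positive; moreover S - 1 is
    -- `fromℕ (suc n)`.
    s = suc (suc n)
    m = s ℕ.* s
    a S : ℝ
    a = 1/1+ (suc n)
    S = fromℕ s

    open UnitPatience R m (m ℕ.* s) a (0≤1/1+ (suc n)) (1/1+n≤1 (suc n)) public

    S*a≡1 : S * a ≡ 1#
    S*a≡1 = [1+n]*1/1+n≡1 (suc n)

    0≤S : 0# ≤ S
    0≤S = 0≤fromℕ s

    m≡S² : fromℕ m ≡ S * S
    m≡S² = fromℕ-* s s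

    -- `greedy-value` with t = S, the order of the standard deviation. The mean a S³ equals the
    -- number S² of vertices u, so the squared bias vanishes; the variance S² (1 - a) and t² amount
    -- to at most 2 S², which is a loss of S after division by 2 S.
    S²-S≤OPT : S * S - S ≤ OPT graph closed
    S²-S≤OPT = ≤-trans (*-cancelˡ-≤ (+-nonneg 0≤S 0≤S) S+S≢0 (≤-trans bound
        (subst₂ (λ j N → (S + S) * j - (j - a * N) * (j - a * N) - N * (a * (1# - a)) - S * S ≤ (S + S) * V)
          (trans (cong fromℕ (length-tabulate {n = m} id)) m≡S²)
          (trans (cong fromℕ (length-tabulate {n = m ℕ.* s} id)) (trans (fromℕ-* m s) (cong (_* S) m≡S²)))
          (greedy-value S (allFin m) (allFin (m ℕ.* s))))))
      greedy≤OPT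
      where
      open Policies R graph using (Val)
      V : ℝ
      V = Val (λ _ → 1#) (greedy (allFin m) (allFin (m ℕ.* s)))
      S+S≢0 : S + S ≢ 0#
      S+S≢0 eq = fromℕ≢0 (suc n) (antisym (≤-by 0≤S eq) 0≤S)
      bound : (S + S) * (S * S - S) ≤
        (S + S) * (S * S) - (S * S - a * (S * S * S)) * (S * S - a * (S * S * S)) - S * S * S * (a * (1# - a)) - S * S
      bound = subst (λ z → (S + S) * (S * S - S) ≤ z)
        (trans (cong (λ z → (S + S) * (S * S) - (S * S - z * (S * S)) * (S * S - z * (S * S)) - S * S * z * (1# - a) - S * S)
                 (sym S*a≡1))
               (solve 2 (λ S a → (S :+ S) :* (S :* S) :- (S :* S :- S :* a :* (S :* S)) :* (S :* S :- S :* a :* (S :* S))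
                    :- S :* S :* (S :* a) :* (:1 :- a) :- S :* S
                  := (S :+ S) :* (S :* S) :- (S :* S :- a :* (S :* S :* S)) :* (S :* S :- a :* (S :* S :* S))
                    :- S :* S :* S :* (a :* (:1 :- a)) :- S :* S) refl S a))
        (≤-by (*-nonneg (*-nonneg 0≤S 0≤S) (0≤1/1+ (suc n)))
          (solve 2 (λ S a → (S :+ S) :* (S :* S :- S) :+ S :* S :* a
             := (S :+ S) :* (S :* S) :- (S :* S :- :1 :* (S :* S)) :* (S :* S :- :1 :* (S :* S))
               :- S :* S :* :1 :* (:1 :- a) :- S :* S) refl S a))

    0<OPT : 0# < OPT graph closed
    0<OPT = ≤-trans 0≤S²-S S²-S≤OPT , λ 0≡OPT → 1≢0 (antisym
      (≤-trans (≤-trans 1≤S²-S S²-S≤OPT) (≤-reflexive (sym 0≡OPT))) 0≤1)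
      where
      N : ℝ
      N = fromℕ n
      1≤S²-S : 1# ≤ S * S - S
      1≤S²-S = ≤-by (+-nonneg 0≤1 (+-nonneg (+-nonneg (0≤fromℕ n) (+-nonneg (0≤fromℕ n) (0≤fromℕ n))) (*-nonneg (0≤fromℕ n) (0≤fromℕ n))))
        (solve 1 (λ N → :1 :+ (:1 :+ (N :+ (N :+ N) :+ N :* N)) := (:1 :+ (:1 :+ N)) :* (:1 :+ (:1 :+ N)) :- (:1 :+ (:1 :+ N))) refl N)
      0≤S²-S : 0# ≤ S * S - S
      0≤S²-S = ≤-trans 0≤1 1≤S²-S

    OPTₙₐ-bound : a * OPTₙₐ graph closed ≤ S - (S - 1#) * (1# / e)
    OPTₙₐ-bound = ≤-trans (*-monoˡ-≤ (0≤1/1+ (suc n)) (≤-trans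
        (OPTₙₐ≤ s (≤-reflexive (fromℕ-* m s)))
        (*-monoˡ-≤ (0≤fromℕ m) (+-monoʳ-≤ 1# (-‿anti ([1-1/n]/e≤[1-1/n]^n n))))))
      (≤-reflexive (trans (cong (λ z → a * (z * (1# - (1# - a) * (1# / e)))) m≡S²) (trans
        (solve 3 (λ S a i → a :* (S :* S :* (:1 :- (:1 :- a) :* i)) := S :* (S :* a) :- (S :* (S :* a) :- S :* a :* (S :* a)) :* i)
          refl S a (1# / e))
        (trans (cong (λ z → S * z - (S * z - z * z) * (1# / e)) S*a≡1)
          (solve 2 (λ S i → S :* :1 :- (S :* :1 :- :1 :* :1) :* i := S :- (S :- :1) :* i) refl S (1# / e))))))
      where
      -‿anti : ∀ {x y} → x ≤ y → - y ≤ - x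
      -‿anti {x} {y} x≤y = ≤-by (x≤y⇒0≤y-x x≤y) (solve 2 (λ x y → :- y :+ (y :- x) := :- x) refl x y)

    -- Scaling by a = 1/S gives c (S - 1) ≤ S - (S - 1) / e = 1 + (S - 1) (1 - 1/e), so `c` exceeds
    -- the constant by at most 1 / (S - 1).
    ratio-bound : ∀ {c} → 0# ≤ c → c * OPT graph closed ≤ OPTₙₐ graph closed → (c - (1# - 1# / e)) * fromℕ (suc n) ≤ 1#
    ratio-bound {c} 0≤c c*OPT≤OPTₙₐ = 0≤y-x⇒x≤y (subst (0# ≤_)
      (solve 3 (λ c i M → (:1 :+ M) :- ((:1 :+ M) :- :1) :* i :- c :* M := :1 :- (c :- (:1 :- i)) :* M) refl c (1# / e) (fromℕ (suc n)))
      (x≤y⇒0≤y-x (≤-trans (≤-reflexive eq) (≤-trans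
        (*-monoˡ-≤ (0≤1/1+ (suc n)) (≤-trans (*-monoˡ-≤ 0≤c S²-S≤OPT) c*OPT≤OPTₙₐ)) OPTₙₐ-bound))))
      where
      eq : c * fromℕ (suc n) ≡ a * (c * (S * S - S))
      eq = begin
        c * fromℕ (suc n)              ≡⟨ solve 2 (λ c M → c :* M := c :* ((:1 :+ M) :* :1 :- :1)) refl c _ ⟩
        c * (S * 1# - 1#)              ≡⟨ cong (λ z → c * (S * z - z)) (sym S*a≡1) ⟩
        c * (S * (S * a) - S * a)      ≡⟨ solve 3 (λ c S a → c :* (S :* (S :* a) :- S :* a) := a :* (c :* (S :* S :- S))) refl c S a ⟩
        a * (c * (S * S - S))          ∎
        where open ≡-Reasoning

  *⁻¹-≤ : ∀ {c x y} → 0# < x → c ≤ y / x → c * x ≤ y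
  *⁻¹-≤ {c} {x} {y} (0≤x , 0≢x) c≤ = subst (c * x ≤_)
    (trans (*-assoc y _ x) (trans (cong (y *_) (⁻¹-inverseˡ x (0≢x ∘ sym))) (*-identityʳ y))) (*-monoʳ-≤ 0≤x c≤)

  ≤-*⁻¹ : ∀ {c x y} → 0# < x → c * x ≤ y → c ≤ y / x
  ≤-*⁻¹ {c} {x} {y} (0≤x , 0≢x) cx≤y = subst (_≤ y / x)
    (trans (*-assoc c x _) (trans (cong (c *_) (⁻¹-inverseʳ x x≢0)) (*-identityʳ c))) (*-monoʳ-≤ (0≤⁻¹ 0≤x x≢0) cx≤y)
    where
    x≢0 : x ≢ 0#
    x≢0 eq = 0≢x (sym eq)

corollary9p4 : (R : CompleteOrderedField) →
    let open CompleteOrderedField R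
        open Euler R
        open StochasticProbing R
    in IsInfimum
         (λ r → Σ[ G ∈ StochasticGraph ] Σ[ closed ∈ SubstringClosed G ]
                  (0# < OPT G closed × r ≡ OPTₙₐ G closed / OPT G closed))
         (1# - 1# / e)
corollary9p4 R =
    (λ { _ (G , closed , 0<OPT , refl) → ≤-*⁻¹ 0<OPT (Rounding.[1-1/e]*OPT≤OPTₙₐ R G closed) })
  , λ c c-lower → greatest c c-lower (total 0# c)
  where
  open OrderedField R
  open Exponential R
  open Tightness R
  open StochasticProbing R
  greatest : ∀ c → IsLowerBound _ c → _ ⊎ _ → c ≤ 1# - 1# / e
  -- The sign is split off because `ratio-bound` multiplies the lower bound on `OPT` by `c`.
  greatest c c-lower (inj₂ c≤0) = ≤-trans c≤0 (0≤1-x 1/e≤1)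
  greatest c c-lower (inj₁ 0≤c) = archimedean {c = 1#} λ
    { zero    → ≤-trans (≤-reflexive (zeroʳ _)) 0≤1
    ; (suc n) → Instance.ratio-bound n 0≤c (*⁻¹-≤ (Instance.0<OPT n)
        (c-lower _ (Instance.graph n , Instance.closed n , Instance.0<OPT n , refl))) }
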